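{- Let $q$ be a prime power, let $n,t,s$ be positive integers with $\gcd(s,n)=1$, and let $\sigma\colon x\mapsto x^{q^s}$ on $\mathbb{F}_{q^{nt}}$ (whose restriction generates $\mathrm{Gal}(\mathbb{F}_{q^n}\colon\mathbb{F}_q)$). Let $a_0,\dots,a_{t-1}\in\mathbb{F}_{q^{nt}}$, \[ G(x)=a_0x+a_1x^{q^n}+\cdots+a_{t-1}x^{q^{n(t-1)}},\qquad F=G\circ\sigma, \] i.e. $F(x)=a_0x^{\sigma}+a_1x^{\sigma q^n}+\cdots+a_{t-1}x^{\sigma q^{n(t-1)}}$, and let \[ \mathcal{L}_F=\{\langle(x,F(x))\rangle_{\mathbb{F}_{q^{nt}}}\colon x\in\mathbb{F}_{q^{nt}}^*\}\subseteq\mathrm{PG}(1,q^{nt}). \] Let $P$ be a point of $\mathcal{L}_F$. Then: - $1\le w_{\mathcal{L}_F}(P)\le t-\dim_{\mathbb{F}_{q^n}}\ker G$ if $P\ne\langle(1,0)\rangle_{\mathbb{F}_{q^{nt}}}$; - $w_{\mathcal{L}_F}(\langle(1,0)\rangle_{\mathbb{F}_{q^{nt}}})=\dim_{\mathbb{F}_q}\ker G=n\cdot\dim_{\mathbb{F}_{q^n}}\ker G$.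
   Context: Notation: $x^{\sigma q^{ni}}:=x^{q^{s+ni}}$. For the $\mathbb{F}_q$-subspace $U=\{(x,F(x))\colon x\in\mathbb{F}_{q^{nt}}\}$ of $\mathbb{F}_{q^{nt}}^2$, the weight of a point $P=\langle\mathbf{u}\rangle_{\mathbb{F}_{q^{nt}}}$ of $\mathrm{PG}(1,q^{nt})$ is $w_{\mathcal{L}_F}(P)=\dim_{\mathbb{F}_q}(U\cap\langle\mathbf{u}\rangle_{\mathbb{F}_{q^{nt}}})$. $\ker G$ is the set of roots of $G$ in $\mathbb{F}_{q^{nt}}$, an $\mathbb{F}_{q^n}$-subspace. -}

module Defs where

open import Algebra.Bundles using (CommutativeRing)
open import Algebra.Definitions.RawMonoid using (sum)
open import Algebra.Module.Bundles using (Module)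
import Algebra.Module.Construct.DirectProduct as DirectProduct
import Algebra.Module.Construct.TensorUnit as TensorUnit
open import Data.Fin.Base using (Fin; toℕ)
open import Data.Nat.Base as ℕ using (ℕ; NonZero)
open import Data.Nat.Primality using (Prime)
open import Data.Product.Base using (∃; ∃-syntax; ∃₂; _×_; _,_; proj₁)
open import Data.Vec.Functional using (Vector)
open import Function.Base using (_∘_)
open import Function.Bundles using (Inverse)
open import Level using (Level; _⊔_; suc)
open import Relation.Binary.Bundles using (Setoid)
import Relation.Binary.Construct.On as On
open import Relation.Binary.PropositionalEquality using (_≡_)
import Relation.Binary.PropositionalEquality.Properties as ≡
open import Relation.Nullary.Negation using (¬_)
open import Relation.Unary using (Pred; _∈_; _∩_; _≐_)

IsPrimePower : ℕ → Set
IsPrimePower q = ∃₂ λ p k → Prime p × NonZero k × q ≡ p ℕ.^ k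

HasOrder : ∀ {a ℓ} → Setoid a ℓ → ℕ → Set (a ⊔ ℓ)
HasOrder S m = Inverse S (≡.setoid (Fin m))

-- A field in the classical sense: no apartness relation is carried, since
-- equality is decidable in the finite fields considered here.
record Field c ℓ : Set (suc (c ⊔ ℓ)) where
  field
    commutativeRing : CommutativeRing c ℓ
  open CommutativeRing commutativeRing public
  field
    1≉0     : ¬ (1# ≈ 0#)
    inverse : ∀ x → ¬ (x ≈ 0#) → ∃[ y ] x * y ≈ 1#
  open import Algebra.Properties.Semiring.Exp semiring public
    using (_^_)

module _ {c ℓ : Level} (K : Field c ℓ) where
  open Field K

  record Subfield p : Set (c ⊔ ℓ ⊔ suc p) where
    field
      Mem        : Pred Carrier p
      resp-≈     : ∀ {x y} → x ≈ y → x ∈ Mem → y ∈ Mem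
      0#-closed  : 0# ∈ Mem
      1#-closed  : 1# ∈ Mem
      +-closed   : ∀ {x y} → x ∈ Mem → y ∈ Mem → x + y ∈ Mem
      neg-closed : ∀ {x} → x ∈ Mem → - x ∈ Mem
      *-closed   : ∀ {x y} → x ∈ Mem → y ∈ Mem → x * y ∈ Mem
      inv-closed : ∀ {x y} → x ∈ Mem → x * y ≈ 1# → y ∈ Mem

    subsetoid : Setoid (c ⊔ p) ℓ
    subsetoid = On.setoid {B = ∃ Mem} setoid proj₁

  -- V is a vector space over K, regarded as a vector space over S ⊆ K.
  module _ {p m ℓm} (S : Subfield p) (V : Module commutativeRing m ℓm) where
    open Subfield S using (Mem)
    open Module V using (Carrierᴹ; _≈ᴹ_; 0ᴹ; _*ₗ_; +ᴹ-rawMonoid)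

    combination : ∀ {d} → Vector Carrier d → Vector Carrierᴹ d → Carrierᴹ
    combination x b = sum +ᴹ-rawMonoid (λ i → x i *ₗ b i)

    Span : ∀ {d} → Vector Carrierᴹ d → Pred Carrierᴹ (c ⊔ p ⊔ ℓm)
    Span b v = ∃[ x ] (∀ i → x i ∈ Mem) × v ≈ᴹ combination x b

    Independent : ∀ {d} → Vector Carrierᴹ d → Set (c ⊔ ℓ ⊔ p ⊔ ℓm)
    Independent b =
      ∀ x → (∀ i → x i ∈ Mem) → combination x b ≈ᴹ 0ᴹ → ∀ i → x i ≈ 0#

    -- W is an S-subspace of V (being a span) and has an S-basis of size d.
    HasDim : ∀ {w} → Pred Carrierᴹ w → ℕ → Set (c ⊔ ℓ ⊔ p ⊔ m ⊔ ℓm ⊔ w)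
    HasDim W d = ∃[ b ] W ≐ Span {d} b × Independent b

  line : Module commutativeRing c ℓ
  line = TensorUnit.⟨module⟩

  plane : Module commutativeRing c ℓ
  plane = DirectProduct.⟨module⟩ line line

  open Module plane using (Carrierᴹ; _≈ᴹ_; 0ᴹ; _*ₗ_)

  -- Points of PG(1,K), given by homogeneous coordinates; the identification
  -- of proportional coordinates is _≈ₚ_.
  record Point : Set (c ⊔ ℓ) where
    constructor ⟨_⟩[_]
    field
      coords  : Carrierᴹ
      nonzero : ¬ (coords ≈ᴹ 0ᴹ)

    subspace : Pred Carrierᴹ (c ⊔ ℓ)
    subspace v = ∃[ r ] v ≈ᴹ r *ₗ coords

  open Point

  _≈ₚ_ : Point → Point → Set (c ⊔ ℓ)
  P ≈ₚ Q = subspace P ≐ subspace Q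

  point-1-0 : Point
  point-1-0 = ⟨ 1# , 0# ⟩[ 1≉0 ∘ proj₁ ]

  graph : (Carrier → Carrier) → Pred Carrierᴹ (c ⊔ ℓ)
  graph F v = ∃[ x ] v ≈ᴹ (x , F x)

  LinearSet : (Carrier → Carrier) → Pred Point (c ⊔ ℓ)
  LinearSet F P = ∃₂ λ x (x≉0 : ¬ (x ≈ 0#)) → P ≈ₚ ⟨ x , F x ⟩[ x≉0 ∘ proj₁ ]

  HasWeight : ∀ {p} → Subfield p → (Carrier → Carrier) → Point → ℕ →
              Set (c ⊔ ℓ ⊔ p)
  HasWeight S F P = HasDim S plane (graph F ∩ subspace P)

  ker : (Carrier → Carrier) → Pred Carrier ℓ
  ker G x = G x ≈ 0#

  frobenius : ℕ → ℕ → Carrier → Carrier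
  frobenius q s x = x ^ (q ℕ.^ s)

  linearized : ∀ (q n : ℕ) {t} → Vector Carrier t → Carrier → Carrier
  linearized q n a x =
    sum +-rawMonoid (λ i → a i * x ^ (q ℕ.^ (n ℕ.* toℕ i)))

module Submission where

-- Let w be the weight of a point ⟨(1, μ)⟩ with μ ≠ 0. It is the dimension of
-- the 𝔽q-space of solutions of F(y) = μ y. As F is σ-semilinear over 𝔽qⁿ and
-- the fixed field of σ in 𝔽qⁿ is 𝔽q, solutions y₁,…,y_w that are independent
-- over 𝔽q are independent over 𝔽qⁿ. Since G(σ yᵢ) = μ yᵢ, the σ yᵢ together
-- with an 𝔽qⁿ-basis of ker G are then independent over 𝔽qⁿ, which gives
-- w + dim ker G ≤ t. Dimensions are compared by counting: a space of dimension
-- d over a field with m elements has mᵈ elements.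

open import Defs
open import Algebra.Module.Bundles using (Module)
open import Data.Fin.Base
  using (Fin; zero; suc; toℕ; fromℕ; inject₁; punchIn; _↑ˡ_; _↑ʳ_; splitAt; join;
         combine; remQuot; funToFin; finToFun)
open import Data.Fin.Permutation as Perm using (Permutation′; _⟨$⟩ʳ_)
import Data.Fin.Properties as Fin
open import Data.Nat.Base as ℕ using (ℕ; zero; suc; NonZero; _∸_; _≤_; _<_; z≤n; s≤s)
open import Data.Nat.Combinatorics as Comb using (_C_)
open import Data.Nat.Divisibility using (_∣_; divides; >⇒∤)
open import Data.Nat.GCD using (GCD; gcd; gcd-GCD; module Bézout)
open import Data.Nat.Primality using (Prime; euclidsLemma)
import Data.Nat.Properties as ℕ
open import Data.Product.Base using (∃; ∃-syntax; _×_; _,_; proj₁; proj₂)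
open import Data.Sum.Base using (inj₁; inj₂)
open import Data.Unit.Base using (⊤; tt)
open import Data.Vec.Base using (Vec; []; _∷_; replicate)
open import Data.Vec.Functional as Vector using (Vector; _++_)
open import Function.Base using (_∘_)
open import Function.Bundles using (Inverse)
open import Level using (Level; _⊔_)
open import Relation.Binary.Bundles using (Setoid)
open import Relation.Binary.Definitions using (Decidable)
open import Relation.Binary.PropositionalEquality as ≡ using (_≡_)
open import Relation.Nullary.Decidable using (Dec; yes; no; map′; _×-dec_; ¬?; decidable-stable)
open import Relation.Nullary.Negation using (¬_; contradiction)
open import Relation.Unary as Unary using (Pred; _∈_; _∩_)

-- The subfields are known only through their orders, and no inclusion between them is given. Each
-- is therefore described by a power map: `𝔽q` is the set of solutions of x^q = x, and elements of
-- `𝔽qⁿ` satisfy x^(q^n) = x. From this come the linearity of `G` over both and, by Bézout for s and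
-- n, the fixed field of `σ`. That x ↦ x^(q^j) is additive is likewise derived from the order of
-- `K`, which forces p · 1 = 0. The obstacle is the twist F(αy) = σ(α)F(y): for μ ≠ 0 the solutions
-- of F(y) = μy are in general closed under scalars from `𝔽q` only, yet the bound involves a
-- dimension over `𝔽qⁿ`. Passing to `𝔽qⁿ` requires cancelling μ. For ⟨(1,0)⟩, where μ = 0, this
-- fails; there the weight is that of the preimage of ker G under the bijection `σ`, so it is the
-- full dimension of ker G over `𝔽q`.

-- Binomial coefficients modulo a prime

[1+n]C[1+k]*[1+k]≡[1+n]*nCk : ∀ n k → (suc n C suc k) ℕ.* suc k ≡ suc n ℕ.* (n C k)
[1+n]C[1+k]*[1+k]≡[1+n]*nCk zero    zero    = ≡.refl
[1+n]C[1+k]*[1+k]≡[1+n]*nCk zero    (suc k) = ≡.refl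
[1+n]C[1+k]*[1+k]≡[1+n]*nCk (suc n) zero    =
  ≡.trans (ℕ.*-identityʳ (suc (suc n) C 1))
    (≡.trans (Comb.nC1≡n (suc (suc n))) (≡.sym (ℕ.*-identityʳ (suc (suc n)))))
[1+n]C[1+k]*[1+k]≡[1+n]*nCk (suc n) (suc k) = begin
  (suc (suc n) C suc (suc k)) ℕ.* suc (suc k)
    ≡⟨ ≡.cong (ℕ._* suc (suc k)) (Comb.nCk+nC[k+1]≡[n+1]C[k+1] (suc n) (suc k)) ⟨
  (A ℕ.+ B) ℕ.* suc (suc k)
    ≡⟨ ℕ.*-distribʳ-+ (suc (suc k)) A B ⟩
  A ℕ.* suc (suc k) ℕ.+ B ℕ.* suc (suc k)
    ≡⟨ ≡.cong₂ ℕ._+_ (≡.trans (ℕ.*-suc A (suc k)) (≡.cong (A ℕ.+_) ([1+n]C[1+k]*[1+k]≡[1+n]*nCk n k)))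
                     ([1+n]C[1+k]*[1+k]≡[1+n]*nCk n (suc k)) ⟩
  (A ℕ.+ suc n ℕ.* (n C k)) ℕ.+ suc n ℕ.* (n C suc k)
    ≡⟨ ℕ.+-assoc A (suc n ℕ.* (n C k)) (suc n ℕ.* (n C suc k)) ⟩
  A ℕ.+ (suc n ℕ.* (n C k) ℕ.+ suc n ℕ.* (n C suc k))
    ≡⟨ ≡.cong (A ℕ.+_) (ℕ.*-distribˡ-+ (suc n) (n C k) (n C suc k)) ⟨
  A ℕ.+ suc n ℕ.* ((n C k) ℕ.+ (n C suc k))
    ≡⟨ ≡.cong (λ z → A ℕ.+ suc n ℕ.* z) (Comb.nCk+nC[k+1]≡[n+1]C[k+1] n k) ⟩
  suc (suc n) ℕ.* A ∎
  where
  open ≡.≡-Reasoning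
  A B : ℕ
  A = suc n C suc k
  B = suc n C suc (suc k)

-- By the absorption identity p divides (p C k) · k, and it cannot divide k, which lies strictly
-- between 0 and p.
prime∣pCk : ∀ {p k} → Prime p → 0 < k → k < p → p ∣ p C k
prime∣pCk {suc n} {suc k} pp _ k<p
  with euclidsLemma (suc n C suc k) (suc k) pp
         (divides (n C k) (≡.trans ([1+n]C[1+k]*[1+k]≡[1+n]*nCk n k) (ℕ.*-comm (suc n) (n C k))))
... | inj₁ p∣C = p∣C
... | inj₂ p∣k = contradiction p∣k (>⇒∤ k<p)

-- Finite setoids and exhaustive search

module _ {a ℓ : Level} {S : Setoid a ℓ} {N : ℕ} (order : HasOrder S N) where
  open Setoid S
  open Inverse order

  from-to : ∀ x → from (to x) ≈ x
  from-to x = inverseʳ ≡.refl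

  to-from : ∀ i → to (from i) ≡ i
  to-from i = inverseˡ refl

  to-injective : ∀ {x y} → to x ≡ to y → x ≈ y
  to-injective {x} {y} eq = trans (sym (from-to x)) (trans (from-cong eq) (from-to y))

  from-injective : ∀ {i j} → from i ≈ from j → i ≡ j
  from-injective {i} {j} eq = ≡.trans (≡.sym (to-from i)) (≡.trans (to-cong eq) (to-from j))

  finite⇒≟ : Decidable _≈_
  finite⇒≟ x y = map′ to-injective to-cong (to x Fin.≟ to y)

  finite⇒∃? : ∀ {p} {P : Pred Carrier p} → (∀ {x y} → x ≈ y → P x → P y) →
              Unary.Decidable P → Dec (∃ P)
  finite⇒∃? resp P? = map′ (λ (i , Pi) → from i , Pi)
                           (λ (x , Px) → to x , resp (sym (from-to x)) Px)
                           (Fin.any? (P? ∘ from))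

-- Arithmetic in a field

module FieldProperties {c ℓ : Level} (K : Field c ℓ) where
  open Field K hiding (zero)
  open import Algebra.Properties.Ring ring
    using (-1*x≈-x; x∙y⁻¹≈ε⇒x≈y)
  open import Algebra.Properties.CommutativeSemiring.Exp commutativeSemiring
    using (^-congˡ; ^-congʳ; ^-assocʳ; ^-distrib-*)
  open import Algebra.Properties.Semiring.Mult semiring as Mult
    using (×1-homo-*; ×-assoc-*; ×-congʳ; ×-assocˡ)
  open import Algebra.Definitions.RawMonoid +-rawMonoid using () renaming (_×_ to _·_)
  import Algebra.Properties.CommutativeMonoid.Sum +-commutativeMonoid as +-Sum
  import Algebra.Properties.CommutativeMonoid.Sum *-commutativeMonoid as *-Sum
  open import Algebra.Properties.CommutativeSemiring.Binomial commutativeSemiring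
    using (binomialTerm) renaming (theorem to binomial-theorem)
  open import Algebra.Solver.Ring.NaturalCoefficients.Default commutativeSemiring
    using (solve; _:=_; _:+_; _:*_)
  open import Relation.Binary.Reasoning.Setoid setoid

  *-cancelˡ-nonzero : ∀ {x y z} → ¬ (x ≈ 0#) → x * y ≈ x * z → y ≈ z
  *-cancelˡ-nonzero {x} {y} {z} x≉0 eq with x′ , xx′≈1 ← inverse x x≉0 = begin
    y               ≈⟨ *-identityˡ y ⟨
    1# * y          ≈⟨ *-congʳ xx′≈1 ⟨
    x * x′ * y      ≈⟨ solve 3 (λ x x′ y → x :* x′ :* y := x′ :* (x :* y)) refl x x′ y ⟩
    x′ * (x * y)    ≈⟨ *-congˡ eq ⟩
    x′ * (x * z)    ≈⟨ solve 3 (λ x x′ y → x :* x′ :* y := x′ :* (x :* y)) refl x x′ z ⟨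
    x * x′ * z      ≈⟨ *-congʳ xx′≈1 ⟩
    1# * z          ≈⟨ *-identityˡ z ⟩
    z               ∎

  cancel-nonzero : ∀ {x y} → ¬ (x ≈ 0#) → x * y ≈ 0# → y ≈ 0#
  cancel-nonzero x≉0 xy≈0 = *-cancelˡ-nonzero x≉0 (trans xy≈0 (sym (zeroʳ _)))

  *-nonzero : ∀ {x y} → ¬ (x ≈ 0#) → ¬ (y ≈ 0#) → ¬ (x * y ≈ 0#)
  *-nonzero x≉0 y≉0 = y≉0 ∘ cancel-nonzero x≉0

  1^ : ∀ n → 1# ^ n ≈ 1#
  1^ zero    = refl
  1^ (suc n) = trans (*-identityˡ (1# ^ n)) (1^ n)

  0^ : ∀ n .{{_ : NonZero n}} → 0# ^ n ≈ 0#
  0^ (suc n) = zeroˡ (0# ^ n)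

  ^-nonzero : ∀ {x} n → ¬ (x ≈ 0#) → ¬ (x ^ n ≈ 0#)
  ^-nonzero zero    x≉0 = 1≉0
  ^-nonzero (suc n) x≉0 = *-nonzero x≉0 (^-nonzero n x≉0)

  *-product-replicate : ∀ n x (f : Vector Carrier n) →
                        *-Sum.sum (λ i → x * f i) ≈ x ^ n * *-Sum.sum f
  *-product-replicate n x f =
    trans (*-Sum.∑-distrib-+ (λ _ → x) f) (*-congʳ (*-Sum.sum-replicate n))

  product-nonzero : ∀ {n} (f : Vector Carrier n) → (∀ i → ¬ (f i ≈ 0#)) → ¬ (*-Sum.sum f ≈ 0#)
  product-nonzero {zero}  f f≉0 = 1≉0
  product-nonzero {suc n} f f≉0 = *-nonzero (f≉0 zero) (product-nonzero (f ∘ suc) (f≉0 ∘ suc))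

  -- Roots of monic polynomials

  -- A vector of length d encodes a monic polynomial of degree d: the leading
  -- coefficient is left out, and the constant one comes first.
  ⟦_⟧ : ∀ {d} → Vec Carrier d → Carrier → Carrier
  ⟦ []     ⟧ x = 1#
  ⟦ a ∷ as ⟧ x = a + x * ⟦ as ⟧ x

  -- Synthetic division by X - r: the coefficients are the partial values of Horner's scheme at r.
  -- The quotient is again monic, so its leading coefficient stays implicit.
  quotient : ∀ {d} → Vec Carrier (suc d) → Carrier → Vec Carrier d
  quotient (_ ∷ [])          r = []
  quotient (_ ∷ as@(_ ∷ _)) r = ⟦ as ⟧ r ∷ quotient as r

  -- Division with remainder at the point x = r + δ. With δ in place of x - r the identity is free
  -- of subtraction and holds in any commutative semiring.
  factor : ∀ {d} (as : Vec Carrier (suc d)) r δ →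
           ⟦ as ⟧ (r + δ) ≈ ⟦ as ⟧ r + δ * ⟦ quotient as r ⟧ (r + δ)
  factor (a ∷ []) r δ =
    solve 4 (λ a r δ u → a :+ (r :+ δ) :* u := (a :+ r :* u) :+ δ :* u) refl a r δ 1#
  factor (a ∷ as@(_ ∷ _)) r δ = begin
    a + (r + δ) * ⟦ as ⟧ (r + δ)  ≈⟨ +-congˡ (*-congˡ (factor as r δ)) ⟩
    a + (r + δ) * (u + δ * h)
      ≈⟨ solve 5 (λ a r δ u h → a :+ (r :+ δ) :* (u :+ δ :* h)
                              := (a :+ r :* u) :+ δ :* (u :+ (r :+ δ) :* h))
           refl a r δ u h ⟩
    (a + r * u) + δ * (u + (r + δ) * h) ∎
    where
    u h : Carrier
    u = ⟦ as ⟧ r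
    h = ⟦ quotient as r ⟧ (r + δ)

  ⟦⟧-cong : ∀ {d} (as : Vec Carrier d) {x y} → x ≈ y → ⟦ as ⟧ x ≈ ⟦ as ⟧ y
  ⟦⟧-cong []       x≈y = refl
  ⟦⟧-cong (a ∷ as) x≈y = +-congˡ (*-cong x≈y (⟦⟧-cong as x≈y))

  -- Induction on the degree: the roots other than r₀ differ from it, so they are roots of the
  -- quotient by X - r₀. In degree 0 the polynomial is the constant 1.
  too-many-roots : ∀ {d} (as : Vec Carrier d) (r : Vector Carrier (suc d)) →
                   (∀ {i j} → r i ≈ r j → i ≡ j) → ¬ (∀ i → ⟦ as ⟧ (r i) ≈ 0#)
  too-many-roots []          r r-inj root = 1≉0 (root zero)
  too-many-roots as@(_ ∷ _) r r-inj root =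
    too-many-roots (quotient as r₀) (r ∘ suc) (Fin.suc-injective ∘ r-inj) λ i →
      cancel-nonzero (λ δ≈0 → contradiction (r-inj (x∙y⁻¹≈ε⇒x≈y _ _ δ≈0)) λ ()) (root′ (suc i))
    where
    r₀ : Carrier
    r₀ = r zero
    split : ∀ x → r₀ + (x - r₀) ≈ x
    split x = begin
      r₀ + (x - r₀)    ≈⟨ solve 3 (λ r x s → r :+ (x :+ s) := x :+ (r :+ s)) refl r₀ x (- r₀) ⟩
      x + (r₀ - r₀)    ≈⟨ +-congˡ (-‿inverseʳ r₀) ⟩
      x + 0#           ≈⟨ +-identityʳ x ⟩
      x                ∎
    root′ : ∀ i → (r i - r₀) * ⟦ quotient as r₀ ⟧ (r i) ≈ 0#
    root′ i = begin
      (r i - r₀) * ⟦ quotient as r₀ ⟧ (r i)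
        ≈⟨ *-congˡ (⟦⟧-cong (quotient as r₀) (split (r i))) ⟨
      (r i - r₀) * ⟦ quotient as r₀ ⟧ (r₀ + (r i - r₀))
        ≈⟨ +-identityˡ _ ⟨
      0# + (r i - r₀) * ⟦ quotient as r₀ ⟧ (r₀ + (r i - r₀))
        ≈⟨ +-congʳ (root zero) ⟨
      ⟦ as ⟧ r₀ + (r i - r₀) * ⟦ quotient as r₀ ⟧ (r₀ + (r i - r₀))
        ≈⟨ factor as r₀ (r i - r₀) ⟨
      ⟦ as ⟧ (r₀ + (r i - r₀))
        ≈⟨ ⟦⟧-cong as (split (r i)) ⟩
      ⟦ as ⟧ (r i)
        ≈⟨ root i ⟩
      0# ∎

  ⟦0⟧ : ∀ d x → ⟦ replicate d 0# ⟧ x ≈ x ^ d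
  ⟦0⟧ zero    x = refl
  ⟦0⟧ (suc d) x = trans (+-identityˡ _) (*-congˡ (⟦0⟧ d x))

  -- Characteristic and additivity of the Frobenius powers

  module _ {N : ℕ} (order : HasOrder setoid N) where
    open Inverse order

    -- Translation by 1 permutes the N elements, so their sum does not change when N · 1 is added to
    -- it.
    order·1≈0 : N · 1# ≈ 0#
    order·1≈0 = begin
      N · 1#                           ≈⟨ +-identityˡ _ ⟨
      0# + N · 1#                      ≈⟨ +-congʳ (-‿inverseˡ Σe) ⟨
      (- Σe + Σe) + N · 1#             ≈⟨ +-assoc _ _ _ ⟩
      - Σe + (Σe + N · 1#)             ≈⟨ +-congˡ shift ⟨
      - Σe + Σe                        ≈⟨ -‿inverseˡ Σe ⟩
      0#                               ∎
      where
      Σe : Carrier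
      Σe = +-Sum.sum from
      translate : Carrier → Fin N → Fin N
      translate x i = to (from i + x)
      translate-cancel : ∀ x y → x + y ≈ 0# → ∀ i → translate y (translate x i) ≡ i
      translate-cancel x y x+y≈0 i = ≡.trans (to-cong (begin
        from (to (from i + x)) + y   ≈⟨ +-congʳ (from-to order (from i + x)) ⟩
        (from i + x) + y             ≈⟨ +-assoc _ _ _ ⟩
        from i + (x + y)             ≈⟨ +-congˡ x+y≈0 ⟩
        from i + 0#                  ≈⟨ +-identityʳ _ ⟩
        from i                       ∎)) (to-from order i)
      π : Permutation′ N
      π = Perm.permutation (translate 1#) (translate (- 1#))
            (translate-cancel (- 1#) 1# (-‿inverseˡ 1#)) (translate-cancel 1# (- 1#) (-‿inverseʳ 1#))
      shift : Σe ≈ Σe + N · 1#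
      shift = begin
        Σe                                   ≈⟨ +-Sum.sum-permute from π ⟩
        +-Sum.sum (λ i → from (π ⟨$⟩ʳ i))    ≈⟨ +-Sum.sum-cong-≋ (λ i → from-to order (from i + 1#)) ⟩
        +-Sum.sum (λ i → from i + 1#)        ≈⟨ +-Sum.∑-distrib-+ from (λ _ → 1#) ⟩
        Σe + +-Sum.sum {N} (λ _ → 1#)        ≈⟨ +-congˡ (+-Sum.sum-replicate N) ⟩
        Σe + N · 1#                          ∎

    -- Multiples of 1 multiply like natural numbers, so as long as p · 1 is nonzero one factor p can
    -- be cancelled; this cannot go on down to 1 = 0.
    [p^M]·1≈0⇒p·1≈0 : ∀ p M → (p ℕ.^ M) · 1# ≈ 0# → p · 1# ≈ 0#
    [p^M]·1≈0⇒p·1≈0 p zero    eq = contradiction (trans (sym (+-identityʳ 1#)) eq) 1≉0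
    [p^M]·1≈0⇒p·1≈0 p (suc M) eq with finite⇒≟ order (p · 1#) 0#
    ... | yes p·1≈0 = p·1≈0
    ... | no  p·1≉0 = [p^M]·1≈0⇒p·1≈0 p M
      (cancel-nonzero p·1≉0 (trans (sym (×1-homo-* p (p ℕ.^ M))) eq))

  AdditivePower : ℕ → Set _
  AdditivePower e = ∀ x y → (x + y) ^ e ≈ x ^ e + y ^ e

  -- In the binomial expansion every coefficient except the two outer ones is a multiple of p, and
  -- such multiples vanish once p · 1 = 0.
  freshman : ∀ {p} → Prime p → p · 1# ≈ 0# → AdditivePower p
  freshman {p@(suc p-1@(suc p-2))} pp p·1≈0 x y = begin
    (x + y) ^ p                                ≈⟨ binomial-theorem p x y ⟩
    +-Sum.sum (binomialTerm x y p)             ≈⟨ +-congˡ (+-Sum.sum-init-last (λ i → binomialTerm x y p (suc i))) ⟩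
    first + (+-Sum.sum middle + last)          ≈⟨ +-cong first≈ (+-cong middle≈0 last≈) ⟩
    y ^ p + (0# + x ^ p)                       ≈⟨ +-congˡ (+-identityˡ _) ⟩
    y ^ p + x ^ p                              ≈⟨ +-comm _ _ ⟩
    x ^ p + y ^ p                              ∎
    where
    first last : Carrier
    first = binomialTerm x y p zero
    last = binomialTerm x y p (suc (fromℕ p-1))
    middle : Vector Carrier p-1
    middle i = binomialTerm x y p (suc (inject₁ i))
    first≈ : first ≈ y ^ p
    first≈ = trans (+-identityʳ _) (*-identityˡ _)
    last≈ : last ≈ x ^ p
    last≈ = begin
      last                              ≡⟨ ≡.cong (λ k → (p C k) · (x ^ k * y ^ (p ∸ k))) (≡.cong suc (Fin.toℕ-fromℕ p-1)) ⟩
      (p C p) · (x ^ p * y ^ (p ∸ p))   ≈⟨ Mult.×-congˡ (Comb.nCn≡1 p) ⟩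
      1 · (x ^ p * y ^ (p ∸ p))         ≈⟨ +-identityʳ _ ⟩
      x ^ p * y ^ (p ∸ p)               ≈⟨ *-congˡ (^-congʳ y (ℕ.n∸n≡0 p)) ⟩
      x ^ p * 1#                        ≈⟨ *-identityʳ _ ⟩
      x ^ p                             ∎
    p·≈0 : ∀ z → p · z ≈ 0#
    p·≈0 z = begin
      p · z           ≈⟨ ×-congʳ p (*-identityˡ z) ⟨
      p · (1# * z)    ≈⟨ ×-assoc-* p 1# z ⟨
      (p · 1#) * z    ≈⟨ *-congʳ p·1≈0 ⟩
      0# * z          ≈⟨ zeroˡ z ⟩
      0#              ∎
    multiple≈0 : ∀ {e} → p ∣ e → ∀ z → e · z ≈ 0#
    multiple≈0 (divides f ≡.refl) z = begin
      (f ℕ.* p) · z   ≈⟨ Mult.×-congˡ (ℕ.*-comm f p) ⟩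
      (p ℕ.* f) · z   ≈⟨ ×-assocˡ z p f ⟨
      p · (f · z)     ≈⟨ p·≈0 _ ⟩
      0#              ∎
    middle≈0 : +-Sum.sum middle ≈ 0#
    middle≈0 = trans (+-Sum.sum-cong-≋ {p-1} {middle} {λ _ → 0#} λ i →
      multiple≈0 (prime∣pCk {k = suc (toℕ (inject₁ i))} pp (s≤s z≤n)
        (s≤s (≡.subst (_< p-1) (≡.sym (Fin.toℕ-inject₁ i)) (Fin.toℕ<n i)))) _)
      (+-Sum.sum-replicate-zero p-1)

  additivePower-^ : ∀ {e} → AdditivePower e → ∀ j → AdditivePower (e ℕ.^ j)
  additivePower-^ {e} add zero    x y = distribʳ 1# x y
  additivePower-^ {e} add (suc j) x y = begin
    (x + y) ^ (e ℕ.* e ℕ.^ j)                 ≈⟨ ^-assocʳ (x + y) e (e ℕ.^ j) ⟨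
    ((x + y) ^ e) ^ (e ℕ.^ j)                 ≈⟨ ^-congˡ (e ℕ.^ j) (add x y) ⟩
    (x ^ e + y ^ e) ^ (e ℕ.^ j)               ≈⟨ additivePower-^ add j _ _ ⟩
    (x ^ e) ^ (e ℕ.^ j) + (y ^ e) ^ (e ℕ.^ j) ≈⟨ +-cong (^-assocʳ x e (e ℕ.^ j)) (^-assocʳ y e (e ℕ.^ j)) ⟩
    x ^ (e ℕ.* e ℕ.^ j) + y ^ (e ℕ.* e ℕ.^ j) ∎

  -- With q = p^k the order of the field is p^(kM), hence p · 1 = 0. Additivity of the p-th power is
  -- then iterated k times to reach q and j times to reach q^j.
  frobenius-additive : ∀ {q M} → IsPrimePower q → HasOrder setoid (q ℕ.^ M) →
                       ∀ j → AdditivePower (q ℕ.^ j)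
  frobenius-additive {M = M} (p , k , pp , _ , ≡.refl) order =
    additivePower-^ (additivePower-^ (freshman pp ([p^M]·1≈0⇒p·1≈0 order p (k ℕ.* M)
      (trans (Mult.×-congˡ (≡.sym (ℕ.^-*-assoc p k M))) (order·1≈0 order)))) k)

  power-injective : ∀ {e} .{{_ : NonZero e}} → Decidable _≈_ → AdditivePower e →
                    ∀ {x y} → x ^ e ≈ y ^ e → x ≈ y
  power-injective {e} _≟_ add {x} {y} eq with (x - y) ≟ 0#
  ... | yes x-y≈0 = x∙y⁻¹≈ε⇒x≈y x y x-y≈0
  ... | no  x-y≉0 = contradiction (begin
    (x - y) ^ e                       ≈⟨ add x (- y) ⟩
    -- Exchanging x^e for y^e and then folding the sum back makes the sign of (- y)^e irrelevant, in
    -- odd and even characteristic alike.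
    x ^ e + (- y) ^ e                 ≈⟨ +-congʳ eq ⟩
    y ^ e + (- y) ^ e                 ≈⟨ add y (- y) ⟨
    (y - y) ^ e                       ≈⟨ ^-congˡ e (-‿inverseʳ y) ⟩
    0# ^ e                            ≈⟨ 0^ e ⟩
    0#                                ∎) (^-nonzero e x-y≉0)

  fixed-iterate : ∀ q n {x} → x ^ (q ℕ.^ n) ≈ x → ∀ i → x ^ (q ℕ.^ (i ℕ.* n)) ≈ x
  fixed-iterate q n {x} fixed zero    = *-identityʳ x
  fixed-iterate q n {x} fixed (suc i) = begin
    x ^ (q ℕ.^ (n ℕ.+ i ℕ.* n))            ≈⟨ ^-congʳ x (ℕ.^-distribˡ-+-* q n (i ℕ.* n)) ⟩
    x ^ (q ℕ.^ n ℕ.* q ℕ.^ (i ℕ.* n))      ≈⟨ ^-assocʳ x (q ℕ.^ n) _ ⟨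
    (x ^ (q ℕ.^ n)) ^ (q ℕ.^ (i ℕ.* n))    ≈⟨ ^-congˡ (q ℕ.^ (i ℕ.* n)) fixed ⟩
    x ^ (q ℕ.^ (i ℕ.* n))                  ≈⟨ fixed-iterate q n fixed i ⟩
    x                                      ∎

  -- Bézout over the naturals yields a multiple of m and a multiple of n that differ by 1, in either
  -- order. Both iterates of the q-th power fix x, so the single step between them does too.
  fixed-coprime : ∀ q m n {x} → gcd m n ≡ 1 → x ^ (q ℕ.^ m) ≈ x → x ^ (q ℕ.^ n) ≈ x → x ^ q ≈ x
  fixed-coprime q m n {x} coprime fix-m fix-n =
    helper (Bézout.identity (≡.subst (GCD m n) coprime (gcd-GCD m n)))
    where
    step : ∀ i j → x ^ (q ℕ.^ i) ≈ x → x ^ (q ℕ.^ j) ≈ x → 1 ℕ.+ i ≡ j → x ^ q ≈ x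
    step i _ fix-i fix-j ≡.refl = begin
      x ^ q                     ≈⟨ ^-congˡ q fix-i ⟨
      (x ^ (q ℕ.^ i)) ^ q       ≈⟨ ^-assocʳ x (q ℕ.^ i) q ⟩
      x ^ (q ℕ.^ i ℕ.* q)       ≈⟨ ^-congʳ x (ℕ.*-comm (q ℕ.^ i) q) ⟩
      x ^ (q ℕ.* q ℕ.^ i)       ≈⟨ fix-j ⟩
      x                         ∎
    helper : Bézout.Identity 1 m n → x ^ q ≈ x
    helper (Bézout.+- a b eq) = step _ _ (fixed-iterate q n fix-n b) (fixed-iterate q m fix-m a) eq
    helper (Bézout.-+ a b eq) = step _ _ (fixed-iterate q m fix-m a) (fixed-iterate q n fix-n b) eq

  -- Finite subfields as fixed points of power maps

  module _ {p : Level} (S : Subfield K p) where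
    open Subfield S

    ^-closed : ∀ {x} n → x ∈ Mem → x ^ n ∈ Mem
    ^-closed zero    x∈S = 1#-closed
    ^-closed (suc n) x∈S = *-closed x∈S (^-closed n x∈S)

  module SubfieldProperties {p : Level} (S : Subfield K p) {m : ℕ}
                            (order : HasOrder (Subfield.subsetoid S) m) where
    open Subfield S
    open Inverse order

    element : Fin m → Carrier
    element i = proj₁ (from i)

    element∈ : ∀ i → element i ∈ Mem
    element∈ i = proj₂ (from i)

    ∈? : Decidable _≈_ → Unary.Decidable Mem
    ∈? _≟_ x = map′ (λ (i , eq) → resp-≈ eq (element∈ i))
                    (λ x∈S → to (x , x∈S) , from-to order (x , x∈S))
                    (Fin.any? (λ i → element i ≟ x))

    1<order : 1 < m
    1<order = Fin.injective⇒≤ {f = f} f-injective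
      where
      f : Fin 2 → Fin m
      f zero       = to (0# , 0#-closed)
      f (suc zero) = to (1# , 1#-closed)
      f-injective : ∀ {i j} → f i ≡ f j → i ≡ j
      f-injective {zero}     {zero}     _  = ≡.refl
      f-injective {zero}     {suc zero} eq = contradiction (sym (to-injective order eq)) 1≉0
      f-injective {suc zero} {zero}     eq = contradiction (to-injective order eq) 1≉0
      f-injective {suc zero} {suc zero} _  = ≡.refl

  -- For x ≠ 0, multiplication by x permutes the nonzero elements e₁,…,eₘ₋₁
  -- of S, so ∏ eᵢ = ∏ (x eᵢ) = xᵐ⁻¹ ∏ eᵢ.
  ∈⇒^order≈id : Decidable _≈_ → ∀ {p} (S : Subfield K p) {m} →
                HasOrder (Subfield.subsetoid S) m → ∀ {x} → x ∈ Subfield.Mem S → x ^ m ≈ x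
  ∈⇒^order≈id _≟_ S {zero}  order x∈S with () ← Inverse.to order (_ , x∈S)
  ∈⇒^order≈id _≟_ S {suc m} order {x} x∈S with x ≟ 0#
  ... | yes x≈0 = trans (*-congʳ x≈0) (trans (zeroˡ _) (sym x≈0))
  ... | no  x≉0 = trans (*-congˡ x^m≈1) (*-identityʳ x)
    where
    open Subfield S
    open Inverse order using (to; to-cong)
    open SubfieldProperties S order
    x′ : Carrier
    x′ = proj₁ (inverse x x≉0)
    xx′≈1 : x * x′ ≈ 1#
    xx′≈1 = proj₂ (inverse x x≉0)
    scale : ∀ {y} → y ∈ Mem → Fin (suc m) → Fin (suc m)
    scale {y} y∈S i = to (y * element i , *-closed y∈S (element∈ i))
    element-scale : ∀ {y} (y∈S : y ∈ Mem) i → element (scale y∈S i) ≈ y * element i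
    element-scale y∈S i = from-to order _
    scale-cancel : ∀ {y z} (y∈S : y ∈ Mem) (z∈S : z ∈ Mem) → z * y ≈ 1# →
                   ∀ i → scale z∈S (scale y∈S i) ≡ i
    scale-cancel {y} {z} y∈S z∈S zy≈1 i = ≡.trans (to-cong (begin
      z * element (scale y∈S i)   ≈⟨ *-congˡ (element-scale y∈S i) ⟩
      z * (y * element i)         ≈⟨ *-assoc z y _ ⟨
      z * y * element i           ≈⟨ *-congʳ zy≈1 ⟩
      1# * element i              ≈⟨ *-identityˡ _ ⟩
      element i                   ∎)) (to-from order i)
    x′∈S : x′ ∈ Mem
    x′∈S = inv-closed x∈S xx′≈1
    π : Permutation′ (suc m)
    π = Perm.permutation (scale x∈S) (scale x′∈S)
          (scale-cancel x′∈S x∈S xx′≈1) (scale-cancel x∈S x′∈S (trans (*-comm x′ x) xx′≈1))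
    i₀ : Fin (suc m)
    i₀ = to (0# , 0#-closed)
    element-i₀ : element i₀ ≈ 0#
    element-i₀ = from-to order _
    element≈0 : ∀ {i} → element i ≈ 0# → i ≡ i₀
    element≈0 eq = from-injective order (trans eq (sym element-i₀))
    π-i₀ : π ⟨$⟩ʳ i₀ ≡ i₀
    π-i₀ = element≈0 (trans (element-scale x∈S i₀) (trans (*-congˡ element-i₀) (zeroʳ x)))
    units : Vector Carrier m
    units = element ∘ punchIn i₀
    ∏units≉0 : ¬ (*-Sum.sum units ≈ 0#)
    ∏units≉0 = product-nonzero units λ i eq → Fin.punchInᵢ≢i i₀ i (element≈0 eq)
    -- `Perm.remove i₀ π` drops the index i₀ and its image. Since π fixes i₀ these coincide, so what
    -- remains permutes the indices of the nonzero elements.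
    permuted : ∀ j → units (Perm.remove i₀ π ⟨$⟩ʳ j) ≈ x * units j
    permuted j = begin
      element (punchIn i₀ (Perm.remove i₀ π ⟨$⟩ʳ j))
        ≡⟨ ≡.cong (λ i → element (punchIn i (Perm.remove i₀ π ⟨$⟩ʳ j))) π-i₀ ⟨
      element (punchIn (π ⟨$⟩ʳ i₀) (Perm.remove i₀ π ⟨$⟩ʳ j))
        ≡⟨ ≡.cong element (Perm.punchIn-permute π i₀ j) ⟨
      element (π ⟨$⟩ʳ (punchIn i₀ j))
        ≈⟨ element-scale x∈S (punchIn i₀ j) ⟩
      x * units j ∎
    x^m≈1 : x ^ m ≈ 1#
    x^m≈1 = *-cancelˡ-nonzero ∏units≉0 (begin
      *-Sum.sum units * x ^ m                   ≈⟨ *-comm _ _ ⟩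
      x ^ m * *-Sum.sum units                   ≈⟨ *-product-replicate m x units ⟨
      *-Sum.sum (λ j → x * units j)             ≈⟨ *-Sum.sum-cong-≋ permuted ⟨
      *-Sum.sum (λ j → units (Perm.remove i₀ π ⟨$⟩ʳ j)) ≈⟨ *-Sum.sum-permute units (Perm.remove i₀ π) ⟨
      *-Sum.sum units                           ≈⟨ *-identityʳ _ ⟨
      *-Sum.sum units * 1#                      ∎)

  -- The m elements of S are already roots of X^m - X, so a fixed point outside S would be root
  -- number m + 1.
  ^order≈id⇒∈ : Decidable _≈_ → ∀ {p} (S : Subfield K p) {m} →
                HasOrder (Subfield.subsetoid S) m → ∀ {x} → x ^ m ≈ x → x ∈ Subfield.Mem S
  ^order≈id⇒∈ _≟_ S {zero}     order fixed = contradiction (SubfieldProperties.1<order S order) λ ()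
  ^order≈id⇒∈ _≟_ S {suc zero} order fixed = contradiction (SubfieldProperties.1<order S order) (ℕ.<-irrefl ≡.refl)
  ^order≈id⇒∈ _≟_ S {m@(suc (suc m-2))} order {x} fixed with SubfieldProperties.∈? S order _≟_ x
  ... | yes x∈S = x∈S
  ... | no  x∉S = contradiction root (too-many-roots xᵐ-x r r-injective)
    where
    open Subfield S
    open SubfieldProperties S order
    -- Constant term 0, linear term -1, then m - 2 zeros below the implicit leading 1. This shape is
    -- the reason for splitting off m ≥ 2, which holds because S contains 0 and 1.
    xᵐ-x : Vec Carrier m
    xᵐ-x = 0# ∷ - 1# ∷ replicate m-2 0#
    r : Vector Carrier (suc m)
    r zero    = x
    r (suc i) = element i
    r-injective : ∀ {i j} → r i ≈ r j → i ≡ j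
    r-injective {zero}  {zero}  _  = ≡.refl
    r-injective {zero}  {suc j} eq = contradiction (resp-≈ (sym eq) (element∈ j)) x∉S
    r-injective {suc i} {zero}  eq = contradiction (resp-≈ eq (element∈ i)) x∉S
    r-injective {suc i} {suc j} eq = ≡.cong suc (from-injective order eq)
    fixed⇒root : ∀ {y} → y ^ m ≈ y → ⟦ xᵐ-x ⟧ y ≈ 0#
    fixed⇒root {y} y^m≈y = begin
      0# + y * (- 1# + y * ⟦ replicate m-2 0# ⟧ y)   ≈⟨ +-identityˡ _ ⟩
      y * (- 1# + y * ⟦ replicate m-2 0# ⟧ y)        ≈⟨ *-congˡ (+-congˡ (*-congˡ (⟦0⟧ m-2 y))) ⟩
      y * (- 1# + y * y ^ m-2)                       ≈⟨ distribˡ y _ _ ⟩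
      y * - 1# + y ^ m                               ≈⟨ +-cong (*-comm y _) y^m≈y ⟩
      - 1# * y + y                                   ≈⟨ +-congʳ (-1*x≈-x y) ⟩
      - y + y                                        ≈⟨ -‿inverseˡ y ⟩
      0#                                             ∎
    root : ∀ i → ⟦ xᵐ-x ⟧ (r i) ≈ 0#
    root zero    = fixed⇒root fixed
    root (suc i) = fixed⇒root (∈⇒^order≈id _≟_ S order (element∈ i))

  -- The whole field as a subfield of itself, so that the power identity for subfields specializes
  -- to `K`.
  total : Subfield K Level.zero
  total = record
    { Mem = λ _ → ⊤ ; resp-≈ = λ _ _ → tt ; 0#-closed = tt ; 1#-closed = tt
    ; +-closed = λ _ _ → tt ; neg-closed = λ _ → tt ; *-closed = λ _ _ → tt
    ; inv-closed = λ _ _ → tt }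

  ^order≈id : ∀ {N} → HasOrder setoid N → ∀ x → x ^ N ≈ x
  ^order≈id order x = ∈⇒^order≈id (finite⇒≟ order) total total-order {x} tt
    where
    open Inverse order
    total-order : HasOrder (Subfield.subsetoid total) _
    total-order = record
      { to = to ∘ proj₁ ; from = λ i → from i , tt ; to-cong = to-cong ; from-cong = from-cong
      ; inverse = inverseˡ , inverseʳ }

-- Numbering functions between finite sets

funToFin-cong : ∀ {d m} {f g : Fin d → Fin m} → (∀ i → f i ≡ g i) → funToFin f ≡ funToFin g
funToFin-cong {zero}  f≗g = ≡.refl
funToFin-cong {suc d} f≗g = ≡.cong₂ combine (f≗g zero) (funToFin-cong (f≗g ∘ suc))

finToFun-injective : ∀ {d m} {j j′ : Fin (m ℕ.^ d)} →
                     (∀ i → finToFun {m} {d} j i ≡ finToFun j′ i) → j ≡ j′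
finToFun-injective {d} {m} {j} {j′} eq = begin
  j                                ≡⟨ Fin.funToFin-finToFin {d} j ⟨
  funToFin (finToFun {m} {d} j)    ≡⟨ funToFin-cong {d} eq ⟩
  funToFin (finToFun {m} {d} j′)   ≡⟨ Fin.funToFin-finToFin {d} j′ ⟩
  j′                               ∎
  where open ≡.≡-Reasoning

-- This bounds the length of an independent family in a finite space, and so the number of rounds in
-- the construction of a basis.
n<m^n : ∀ {m} → 1 < m → ∀ n → n < m ℕ.^ n
n<m^n 1<m zero    = s≤s z≤n
n<m^n {m} 1<m (suc n) = begin-strict
  suc n                   ≤⟨ n<m^n 1<m n ⟩
  m ℕ.^ n                 <⟨ ℕ.m<m*n (m ℕ.^ n) m ⦃ ℕ.>-nonZero (ℕ.≤-<-trans z≤n (n<m^n 1<m n)) ⦄ 1<m ⟩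
  m ℕ.^ n ℕ.* m           ≡⟨ ℕ.*-comm (m ℕ.^ n) m ⟩
  m ℕ.* m ℕ.^ n           ∎
  where open ℕ.≤-Reasoning

-- Linear algebra over a subfield

module VectorSpace {c ℓ : Level} (K : Field c ℓ) {p mᵛ ℓᵛ : Level} (S : Subfield K p)
                   (V : Module (Field.commutativeRing K) mᵛ ℓᵛ) where
  open Field K hiding (zero)
  open FieldProperties K
  open Subfield S
  open Module V
  open import Algebra.Properties.Group +-group using () renaming (x∙y⁻¹≈ε⇒x≈y to x-y≈0⇒x≈y)
  open import Algebra.Properties.Group +ᴹ-group using () renaming (inverseʳ-unique to -ᴹ-unique)
  import Algebra.Properties.CommutativeMonoid.Sum +ᴹ-commutativeMonoid as Sum
  open import Relation.Binary.Reasoning.Setoid ≈ᴹ-setoid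

  comb : ∀ {d} → Vector Carrier d → Vector Carrierᴹ d → Carrierᴹ
  comb = combination K S V

  comb-cong : ∀ {d} {x y : Vector Carrier d} {b} → (∀ i → x i ≈ y i) → comb x b ≈ᴹ comb y b
  comb-cong x≈y = Sum.sum-cong-≋ (λ i → *ₗ-cong (x≈y i) ≈ᴹ-refl)

  comb-+ : ∀ {d} (x y : Vector Carrier d) b → comb (λ i → x i + y i) b ≈ᴹ comb x b +ᴹ comb y b
  comb-+ x y b = ≈ᴹ-trans (Sum.sum-cong-≋ (λ i → *ₗ-distribʳ (b i) (x i) (y i)))
                          (Sum.∑-distrib-+ (λ i → x i *ₗ b i) (λ i → y i *ₗ b i))

  comb-* : ∀ {d} r (x : Vector Carrier d) b → comb (λ i → r * x i) b ≈ᴹ r *ₗ comb x b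
  comb-* {zero}  r x b = ≈ᴹ-sym (*ₗ-zeroʳ r)
  comb-* {suc d} r x b = ≈ᴹ-trans
    (+ᴹ-cong (*ₗ-assoc r (x zero) (b zero)) (comb-* r (x ∘ suc) (b ∘ suc)))
    (≈ᴹ-sym (*ₗ-distribˡ r _ _))

  comb-0 : ∀ {d} (b : Vector Carrierᴹ d) → comb (λ _ → 0#) b ≈ᴹ 0ᴹ
  comb-0 {d} b = ≈ᴹ-trans (Sum.sum-cong-≋ {d} (λ i → *ₗ-zeroˡ (b i))) (Sum.sum-replicate-zero d)

  comb-neg : ∀ {d} (x : Vector Carrier d) b → comb (λ i → - x i) b ≈ᴹ -ᴹ comb x b
  comb-neg {d} x b = -ᴹ-unique _ _ (begin
    comb x b +ᴹ comb (λ i → - x i) b   ≈⟨ comb-+ x (λ i → - x i) b ⟨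
    comb (λ i → x i - x i) b           ≈⟨ comb-cong (λ i → -‿inverseʳ (x i)) ⟩
    comb (λ _ → 0#) b                  ≈⟨ comb-0 b ⟩
    0ᴹ                                 ∎)

  comb-++ : ∀ {d e} (x : Vector Carrier (d ℕ.+ e)) (b : Vector Carrierᴹ d) (b′ : Vector Carrierᴹ e) →
            comb x (b ++ b′) ≈ᴹ comb (λ i → x (i ↑ˡ e)) b +ᴹ comb (λ i → x (d ↑ʳ i)) b′
  comb-++ {zero}  x b b′ = ≈ᴹ-sym (+ᴹ-identityˡ _)
  comb-++ {suc d} {e} x b b′ = ≈ᴹ-trans
    (+ᴹ-congˡ (≈ᴹ-trans (Sum.sum-cong-≋ {d ℕ.+ e} (λ i → *ₗ-congˡ (≈ᴹ-reflexive (++-suc i))))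
                        (comb-++ (x ∘ suc) (b ∘ suc) b′)))
    (≈ᴹ-sym (+ᴹ-assoc _ _ _))
    where
    ++-suc : ∀ i → (b ++ b′) (suc i) ≡ ((b ∘ suc) ++ b′) i
    ++-suc i with splitAt d i
    ... | inj₁ _ = ≡.refl
    ... | inj₂ _ = ≡.refl

  ∈Span : ∀ {d} (b : Vector Carrierᴹ d) i → b i ∈ Span K S V b
  ∈Span b zero    = 1# Vector.∷ (λ _ → 0#) , (λ { zero → 1#-closed ; (suc i) → 0#-closed }) ,
    ≈ᴹ-sym (≈ᴹ-trans (+ᴹ-cong (*ₗ-identityˡ (b zero)) (comb-0 (b ∘ suc))) (+ᴹ-identityʳ (b zero)))
  ∈Span b (suc i) with x , x∈ , eq ← ∈Span (b ∘ suc) i =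
    0# Vector.∷ x , (λ { zero → 0#-closed ; (suc i) → x∈ i }) ,
    ≈ᴹ-trans eq (≈ᴹ-sym (≈ᴹ-trans (+ᴹ-congʳ (*ₗ-zeroˡ (b zero))) (+ᴹ-identityˡ _)))

  record IsSubspace {w} (W : Pred Carrierᴹ w) : Set (c ⊔ p ⊔ mᵛ ⊔ ℓᵛ ⊔ w) where
    field
      resp : ∀ {u v} → u ≈ᴹ v → u ∈ W → v ∈ W
      0∈   : 0ᴹ ∈ W
      +∈   : ∀ {u v} → u ∈ W → v ∈ W → u +ᴹ v ∈ W
      *∈   : ∀ {r v} → r ∈ Mem → v ∈ W → r *ₗ v ∈ W

    comb∈ : ∀ {d} {x : Vector Carrier d} {b} →
            (∀ i → x i ∈ Mem) → (∀ i → b i ∈ W) → comb x b ∈ W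
    comb∈ {zero}  x∈ b∈ = 0∈
    comb∈ {suc d} x∈ b∈ = +∈ (*∈ (x∈ zero) (b∈ zero)) (comb∈ (x∈ ∘ suc) (b∈ ∘ suc))

  Span-resp : ∀ {d} {b : Vector Carrierᴹ d} {u v} → u ≈ᴹ v → u ∈ Span K S V b → v ∈ Span K S V b
  Span-resp u≈v (x , x∈ , u≈) = x , x∈ , ≈ᴹ-trans (≈ᴹ-sym u≈v) u≈

  -- If v had a nonzero coefficient in a relation, dividing by it would put v into the span.
  -- Otherwise the relation involves b alone.
  independent-∷ : Decidable _≈_ → ∀ {d v} {b : Vector Carrierᴹ d} →
                  Independent K S V b → ¬ (v ∈ Span K S V b) → Independent K S V (v Vector.∷ b)
  independent-∷ _≟_ {d} {v} {b} b-ind v∉ x x∈ eq with x zero ≟ 0#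
  ... | no x₀≉0 with y , x₀y≈1 ← inverse (x zero) x₀≉0 =
    contradiction ((λ i → y * - x (suc i)) ,
                   (λ i → *-closed (inv-closed (x∈ zero) x₀y≈1) (neg-closed (x∈ (suc i)))) ,
                   v≈) v∉
    where
    v≈ : v ≈ᴹ comb (λ i → y * - x (suc i)) b
    v≈ = begin
      v                                   ≈⟨ *ₗ-identityˡ v ⟨
      1# *ₗ v                             ≈⟨ *ₗ-congʳ (trans (*-comm _ _) x₀y≈1) ⟨
      (y * x zero) *ₗ v                   ≈⟨ *ₗ-assoc y (x zero) v ⟩
      y *ₗ x zero *ₗ v                    ≈⟨ *ₗ-congˡ (-ᴹ-unique _ _ (≈ᴹ-trans (+ᴹ-comm _ _) eq)) ⟩
      y *ₗ (-ᴹ comb (x ∘ suc) b)          ≈⟨ *ₗ-congˡ (comb-neg (x ∘ suc) b) ⟨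
      y *ₗ comb (λ i → - x (suc i)) b     ≈⟨ comb-* y (λ i → - x (suc i)) b ⟨
      comb (λ i → y * - x (suc i)) b      ∎
  ... | yes x₀≈0 = λ where
      zero    → x₀≈0
      (suc i) → b-ind (x ∘ suc) (x∈ ∘ suc) tail≈0 i
    where
    tail≈0 : comb (x ∘ suc) b ≈ᴹ 0ᴹ
    tail≈0 = begin
      comb (x ∘ suc) b                    ≈⟨ +ᴹ-identityˡ _ ⟨
      0ᴹ +ᴹ comb (x ∘ suc) b              ≈⟨ +ᴹ-congʳ (*ₗ-zeroˡ v) ⟨
      0# *ₗ v +ᴹ comb (x ∘ suc) b         ≈⟨ +ᴹ-congʳ (*ₗ-congʳ x₀≈0) ⟨
      x zero *ₗ v +ᴹ comb (x ∘ suc) b     ≈⟨ eq ⟩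
      0ᴹ                                  ∎

  independent-tail : ∀ {d} {b : Vector Carrierᴹ (suc d)} →
                     Independent K S V b → Independent K S V (b ∘ suc)
  independent-tail {b = b} b-ind x x∈ eq i =
    b-ind (0# Vector.∷ x) (λ { zero → 0#-closed ; (suc i) → x∈ i })
      (≈ᴹ-trans (+ᴹ-cong (*ₗ-zeroˡ (b zero)) eq) (+ᴹ-identityˡ 0ᴹ)) (suc i)

  -- Counting vectors and finding bases

  module Finite {m : ℕ} (order : HasOrder (Subfield.subsetoid S) m) where
    open SubfieldProperties S order
    open Inverse order using (to; to-cong)

    -- The d base-m digits of the index select elements of S, so every coefficient vector over S has
    -- a number below m^d.
    coefficients : ∀ {d} → Fin (m ℕ.^ d) → Vector Carrier d
    coefficients j = element ∘ finToFun j

    index : ∀ {d} (x : Vector Carrier d) → (∀ i → x i ∈ Mem) → Fin (m ℕ.^ d)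
    index x x∈ = funToFin (λ i → to (x i , x∈ i))

    coefficients-index : ∀ {d} (x : Vector Carrier d) (x∈ : ∀ i → x i ∈ Mem) i →
                         coefficients (index x x∈) i ≈ x i
    coefficients-index x x∈ i =
      trans (reflexive (≡.cong element (Fin.finToFun-funToFin (λ i → to (x i , x∈ i)) i)))
            (from-to order _)

    coefficients-injective : ∀ {d} {j j′ : Fin (m ℕ.^ d)} →
                             (∀ i → coefficients {d} j i ≈ coefficients j′ i) → j ≡ j′
    coefficients-injective {d} eq = finToFun-injective {d} (λ i → from-injective order (eq i))

    comb-coefficients-injective : ∀ {d} {b : Vector Carrierᴹ d} → Independent K S V b →
      ∀ {j j′} → comb (coefficients j) b ≈ᴹ comb (coefficients j′) b → j ≡ j′
    comb-coefficients-injective {d} {b} b-ind {j} {j′} eq = coefficients-injective {d} λ i →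
      x-y≈0⇒x≈y _ _ (b-ind (λ i → x i - y i)
        (λ i → +-closed (element∈ _) (neg-closed (element∈ _))) x-y≈0 i)
      where
      x y : Vector Carrier d
      x = coefficients j
      y = coefficients j′
      x-y≈0 : comb (λ i → x i - y i) b ≈ᴹ 0ᴹ
      x-y≈0 = begin
        comb (λ i → x i - y i) b             ≈⟨ comb-+ x (λ i → - y i) b ⟩
        comb x b +ᴹ comb (λ i → - y i) b     ≈⟨ +ᴹ-cong eq (comb-neg y b) ⟩
        comb y b +ᴹ -ᴹ comb y b              ≈⟨ -ᴹ‿inverseʳ _ ⟩
        0ᴹ                                   ∎

    -- The m^d combinations of an independent family are distinct, so labels that tell them apart
    -- need at least m^d values. The labelling `f` receives the membership proofs because a label
    -- may be computed from them.
    independent⇒m^d≤ : ∀ {d N} {b : Vector Carrierᴹ d} → Independent K S V b →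
      (f : ∀ x → (∀ i → x i ∈ Mem) → Fin N) →
      (∀ {x x∈ y y∈} → f x x∈ ≡ f y y∈ → comb x b ≈ᴹ comb y b) → m ℕ.^ d ≤ N
    independent⇒m^d≤ {d} b-ind f f-inj =
      Fin.injective⇒≤ {f = λ j → f (coefficients {d} j) (λ _ → element∈ _)}
        (comb-coefficients-injective b-ind ∘ f-inj)

    Span? : Decidable _≈ᴹ_ → ∀ {d} (b : Vector Carrierᴹ d) → Unary.Decidable (Span K S V b)
    Span? _≟_ {d} b v = map′
      (λ (j , eq) → coefficients j , (λ _ → element∈ _) , eq)
      (λ (x , x∈ , eq) → index x x∈ , ≈ᴹ-trans eq (comb-cong (λ i → sym (coefficients-index x x∈ i))))
      (Fin.any? (λ j → v ≟ comb (coefficients {d} j) b))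

    -- Greedy extension: search W for a vector outside the current span and adjoin it; when there is
    -- none, the family spans W. The fuel plus the length of the family always stays at least N.
    basis : Decidable _≈_ → ∀ {N} → HasOrder ≈ᴹ-setoid N →
            ∀ {w} {W : Pred Carrierᴹ w} → IsSubspace W → Unary.Decidable W →
            ∃[ d ] HasDim K S V W d
    basis _≟_ {N} orderV {W = W} W-sub W? =
      extend N {0} {λ ()} (λ ()) (λ _ _ _ ()) (ℕ.≤-reflexive (≡.sym (ℕ.+-identityʳ N)))
      where
      open IsSubspace W-sub
      extend : ∀ fuel {d} {b : Vector Carrierᴹ d} → (∀ i → b i ∈ W) → Independent K S V b →
               N ≤ fuel ℕ.+ d → ∃[ d ] HasDim K S V W d
      extend fuel {d} {b} b∈ b-ind N≤
        with finite⇒∃? orderV {P = λ v → v ∈ W × ¬ (v ∈ Span K S V b)}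
               (λ u≈v (u∈ , u∉) → resp u≈v u∈ , u∉ ∘ Span-resp (≈ᴹ-sym u≈v))
               (λ v → W? v ×-dec ¬? (Span? (finite⇒≟ orderV) b v))
      extend fuel {d} {b} b∈ b-ind N≤ | no none = d , b ,
        ((λ {v} v∈ → decidable-stable (Span? (finite⇒≟ orderV) b v) (λ v∉ → none (v , v∈ , v∉))) ,
         (λ (x , x∈ , v≈) → resp (≈ᴹ-sym v≈) (comb∈ x∈ b∈))) ,
        b-ind
      -- Without fuel N ≤ d, whereas the d independent vectors give d < m^d ≤ N.
      extend zero {d} {b} b∈ b-ind N≤ | yes _ = contradiction
        (ℕ.≤-trans (n<m^n 1<order d) (ℕ.≤-trans m^d≤N N≤)) (ℕ.<-irrefl ≡.refl)
        where
        m^d≤N : m ℕ.^ d ≤ N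
        m^d≤N = independent⇒m^d≤ b-ind (λ x _ → Inverse.to orderV (comb x b)) (to-injective orderV)
      extend (suc fuel) {d} {b} b∈ b-ind N≤ | yes (v , v∈ , v∉) =
        extend fuel {b = v Vector.∷ b} (λ { zero → v∈ ; (suc i) → b∈ i })
          (independent-∷ _≟_ b-ind v∉) (ℕ.≤-trans N≤ (ℕ.≤-reflexive (≡.sym (ℕ.+-suc fuel d))))

-- Comparing dimensions

open import Data.Nat.Base using (_*_; _^_)

^-cancelʳ-≤ : ∀ {m} → 1 < m → ∀ {a b} → m ^ a ≤ m ^ b → a ≤ b
^-cancelʳ-≤ {m} 1<m mᵃ≤mᵇ = ℕ.≮⇒≥ λ b<a → ℕ.<⇒≱ (ℕ.^-monoʳ-< m 1<m b<a) mᵃ≤mᵇ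

-- W has m^d elements, W′ has m′^d′, and φ embeds one in the other as a set. This compares spaces
-- over different subfields and in different ambient modules.
dimension-≤ : ∀ {c ℓ} (K : Field c ℓ) {p m₁ ℓ₁ p′ m₂ ℓ₂ w w′}
  (S : Subfield K p) {m : ℕ} → HasOrder (Subfield.subsetoid S) m →
  (S′ : Subfield K p′) {m′ : ℕ} → HasOrder (Subfield.subsetoid S′) m′ →
  (V : Module (Field.commutativeRing K) m₁ ℓ₁) (V′ : Module (Field.commutativeRing K) m₂ ℓ₂)
  (W : Pred (Module.Carrierᴹ V) w) (W′ : Pred (Module.Carrierᴹ V′) w′) {d d′ : ℕ} →
  HasDim K S V W d → HasDim K S′ V′ W′ d′ →
  (φ : Module.Carrierᴹ V → Module.Carrierᴹ V′) → (∀ {v} → v ∈ W → φ v ∈ W′) →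
  (∀ {u v} → u ∈ W → v ∈ W → Module._≈ᴹ_ V′ (φ u) (φ v) → Module._≈ᴹ_ V u v) →
  m ^ d ≤ m′ ^ d′
dimension-≤ K S order S′ order′ V V′ W _ {d′ = d′}
  (b , (_ , Span⊆W) , b-ind) (b′ , (W′⊆Span , _) , _) φ φ∈ φ-inj =
  F.independent⇒m^d≤ b-ind
    (λ x x∈ → F′.index (proj₁ (coords x∈)) (proj₁ (proj₂ (coords x∈))))
    -- Equal labels mean equal coordinates of the two images under φ, hence equal images.
    (λ {x} {x∈} {y} {y∈} eq → φ-inj (∈W x∈) (∈W y∈)
      (V′.≈ᴹ-trans (proj₂ (proj₂ (coords x∈)))
        (V′.≈ᴹ-trans (VS′.comb-cong λ i →
            trans (sym (F′.coefficients-index _ (proj₁ (proj₂ (coords x∈))) i))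
              (trans (reflexive (≡.cong (λ j → F′.coefficients {d′} j i) eq))
                     (F′.coefficients-index _ (proj₁ (proj₂ (coords y∈))) i)))
          (V′.≈ᴹ-sym (proj₂ (proj₂ (coords y∈)))))))
  where
  open Field K using (trans; sym; reflexive; Carrier)
  module V′ = Module V′
  module VS = VectorSpace K S V
  module VS′ = VectorSpace K S′ V′
  module F = VS.Finite order
  module F′ = VS′.Finite order′
  ∈W : ∀ {x} → (∀ i → x i ∈ Subfield.Mem S) → VS.comb x b ∈ W
  ∈W {x} x∈ = Span⊆W (x , x∈ , Module.≈ᴹ-refl V)
  coords : ∀ {x} → (∀ i → x i ∈ Subfield.Mem S) → φ (VS.comb x b) ∈ Span K S′ V′ b′
  coords x∈ = W′⊆Span (φ∈ (∈W x∈))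

-- Semilinear maps and independence in `K`

module Line {c ℓ : Level} (K : Field c ℓ) {p : Level} (S : Subfield K p) where
  open Field K hiding (zero; _^_) renaming (_*_ to _·_)
  open FieldProperties K
  open Subfield S
  open import Algebra.Properties.Ring ring using (x+x≈x⇒x≈0)
  open import Algebra.Properties.CommutativeSemigroup *-commutativeSemigroup using (x∙yz≈y∙xz)
  open VectorSpace K S (line K) public
  open import Relation.Binary.Reasoning.Setoid setoid

  comb-scaled : ∀ {d} r (x b : Vector Carrier d) → comb x (λ i → r · b i) ≈ r · comb x b
  comb-scaled {zero}  r x b = sym (zeroʳ r)
  comb-scaled {suc d} r x b =
    trans (+-cong (x∙yz≈y∙xz (x zero) r (b zero)) (comb-scaled r (x ∘ suc) (b ∘ suc)))
          (sym (distribˡ r _ _))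

  comb-congʳ : ∀ {d} (x : Vector Carrier d) {b b′} → (∀ i → b i ≈ b′ i) → comb x b ≈ comb x b′
  comb-congʳ {zero}  x b≈b′ = refl
  comb-congʳ {suc d} x b≈b′ = +-cong (*-congˡ (b≈b′ zero)) (comb-congʳ (x ∘ suc) (b≈b′ ∘ suc))

  comb-zipped : ∀ {d} (x : Vector Carrier d) (b : Vector (Carrier × Carrier) d) →
                Module._≈ᴹ_ (plane K) (combination K S (plane K) x b)
                  (comb x (proj₁ ∘ b) , comb x (proj₂ ∘ b))
  comb-zipped {zero}  x b = refl , refl
  comb-zipped {suc d} x b with eq₁ , eq₂ ← comb-zipped (x ∘ suc) (b ∘ suc) = +-congˡ eq₁ , +-congˡ eq₂

  module _ {f : Carrier → Carrier} (f-cong : ∀ {x y} → x ≈ y → f x ≈ f y)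
           (f-+ : ∀ x y → f (x + y) ≈ f x + f y) where

    additive-0 : f 0# ≈ 0#
    additive-0 = x+x≈x⇒x≈0 (f 0#) (trans (sym (f-+ 0# 0#)) (f-cong (+-identityˡ 0#)))

    -- With the identity for τ this also serves linear maps.
    semilinear-comb : {τ : Carrier → Carrier} →
      (∀ {α} → α ∈ Mem → ∀ x → f (α · x) ≈ τ α · f x) →
      ∀ {d} {x : Vector Carrier d} {b} → (∀ i → x i ∈ Mem) → f (comb x b) ≈ comb (τ ∘ x) (f ∘ b)
    semilinear-comb f-* {zero}  x∈ = additive-0
    semilinear-comb f-* {suc d} x∈ =
      trans (f-+ _ _) (+-cong (f-* (x∈ zero) _) (semilinear-comb f-* (x∈ ∘ suc)))

    linear⇒ker-subspace : (∀ {α} → α ∈ Mem → ∀ x → f (α · x) ≈ α · f x) → IsSubspace (ker K f)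
    linear⇒ker-subspace f-* = record
      { resp = λ u≈v fu≈0 → trans (f-cong (sym u≈v)) fu≈0
      ; 0∈   = additive-0
      ; +∈   = λ fu≈0 fv≈0 → trans (f-+ _ _) (trans (+-cong fu≈0 fv≈0) (+-identityˡ 0#))
      ; *∈   = λ r∈ fv≈0 → trans (f-* r∈ _) (trans (*-congˡ fv≈0) (zeroʳ _))
      }

  -- The dimensions add up because G kills the first family and maps the
  -- second one to a multiple of an independent family.
  independent-++ : ∀ {G μ} (_ : ¬ (μ ≈ 0#)) → (∀ {x y} → x ≈ y → G x ≈ G y) →
    (∀ x y → G (x + y) ≈ G x + G y) → (∀ {α} → α ∈ Mem → ∀ x → G (α · x) ≈ α · G x) →
    ∀ {k w} {b : Vector Carrier k} {y z : Vector Carrier w} →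
    Independent K S (line K) b → (∀ {x} → (∀ i → x i ∈ Mem) → G (comb x b) ≈ 0#) →
    Independent K S (line K) y → (∀ i → G (z i) ≈ μ · y i) →
    Independent K S (line K) (b ++ z)
  independent-++ {G} {μ} μ≉0 G-cong G-+ G-* {k} {w} {b} {y} {z} b-ind Gb≈0 y-ind Gz≈μy x x∈ eq i =
    ≡.subst (λ i → x i ≈ 0#) (Fin.join-splitAt k w i) (vanish (splitAt k i))
    where
    xˡ : Vector Carrier k
    xˡ i = x (i ↑ˡ w)
    xʳ : Vector Carrier w
    xʳ i = x (k ↑ʳ i)
    split : comb xˡ b + comb xʳ z ≈ 0#
    split = trans (sym (comb-++ x b z)) eq
    xʳ≈0 : ∀ i → xʳ i ≈ 0#
    xʳ≈0 = y-ind xʳ (λ i → x∈ (k ↑ʳ i)) (cancel-nonzero μ≉0 (begin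
      μ · comb xʳ y                        ≈⟨ comb-scaled μ xʳ y ⟨
      comb xʳ (λ i → μ · y i)              ≈⟨ comb-congʳ xʳ Gz≈μy ⟨
      comb xʳ (G ∘ z)                      ≈⟨ semilinear-comb G-cong G-+ G-* (λ i → x∈ (k ↑ʳ i)) ⟨
      G (comb xʳ z)                        ≈⟨ +-identityˡ _ ⟨
      0# + G (comb xʳ z)                   ≈⟨ +-congʳ (Gb≈0 (λ i → x∈ (i ↑ˡ w))) ⟨
      G (comb xˡ b) + G (comb xʳ z)        ≈⟨ G-+ _ _ ⟨
      G (comb xˡ b + comb xʳ z)            ≈⟨ G-cong split ⟩
      G 0#                                 ≈⟨ additive-0 G-cong G-+ ⟩
      0#                                   ∎))
    xˡ≈0 : ∀ i → xˡ i ≈ 0#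
    xˡ≈0 = b-ind xˡ (λ i → x∈ (i ↑ˡ w)) (begin
      comb xˡ b                            ≈⟨ +-identityʳ _ ⟨
      comb xˡ b + 0#                       ≈⟨ +-congˡ (trans (comb-cong xʳ≈0) (comb-0 z)) ⟨
      comb xˡ b + comb xʳ z                ≈⟨ split ⟩
      0#                                   ∎)
    vanish : ∀ i → x (join k w i) ≈ 0#
    vanish (inj₁ i) = xˡ≈0 i
    vanish (inj₂ i) = xʳ≈0 i

  -- Dedekind's argument: subtracting from a shortest relation with leading
  -- coefficient 1 its image under f leaves a shorter one, so its coefficients
  -- are fixed by τ.
  module _ (_≟_ : Decidable _≈_) {p′ : Level} (S₀ : Subfield K p′) {τ : Carrier → Carrier}
           (τ-cong : ∀ {x y} → x ≈ y → τ x ≈ τ y) (τ-1 : τ 1# ≈ 1#)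
           (τ∈ : ∀ {α} → α ∈ Mem → τ α ∈ Mem)
           (fixed∈ : ∀ {α} → α ∈ Mem → τ α ≈ α → α ∈ Subfield.Mem S₀)
           {f : Carrier → Carrier} (f-cong : ∀ {x y} → x ≈ y → f x ≈ f y)
           (f-+ : ∀ x y → f (x + y) ≈ f x + f y)
           (f-* : ∀ {α} → α ∈ Mem → ∀ x → f (α · x) ≈ τ α · f x)
           {μ : Carrier} (μ≉0 : ¬ (μ ≈ 0#)) where
    open import Algebra.Properties.Group +-group using (x∙y⁻¹≈ε⇒x≈y; x≈y⇒x∙y⁻¹≈ε; ε⁻¹≈ε)
    private module Line₀ = VectorSpace K S₀ (line K)

    eigenvectors-independent : ∀ {d} {y : Vector Carrier d} → (∀ i → f (y i) ≈ μ · y i) →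
      Independent K S₀ (line K) y → Independent K S (line K) y
    eigenvectors-independent {zero}  fy≈μy y-ind x x∈ eq ()
    eigenvectors-independent {suc d} {y} fy≈μy y-ind x x∈ eq = vanish
      where
      -- Independence of the tail over `S`, known by induction on the length, takes the place of
      -- choosing a shortest relation.
      tail-ind : Independent K S (line K) (y ∘ suc)
      tail-ind = eigenvectors-independent (fy≈μy ∘ suc) (Line₀.independent-tail {b = y} y-ind)
      tail≈0 : ∀ (x : Vector Carrier (suc d)) → x zero ≈ 0# → comb x y ≈ 0# →
               comb (x ∘ suc) (y ∘ suc) ≈ 0#
      tail≈0 x x₀≈0 eq = begin
        comb (x ∘ suc) (y ∘ suc)                     ≈⟨ +-identityˡ _ ⟨
        0# + comb (x ∘ suc) (y ∘ suc)                ≈⟨ +-congʳ (trans (*-congʳ x₀≈0) (zeroˡ _)) ⟨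
        x zero · y zero + comb (x ∘ suc) (y ∘ suc)   ≈⟨ eq ⟩
        0#                                           ∎
      normalized : ∀ (z : Vector Carrier (suc d)) → (∀ i → z i ∈ Mem) → z zero ≈ 1# →
                   ¬ (comb z y ≈ 0#)
      -- Once all coefficients lie in `S₀`, independence over `S₀` makes the leading one vanish,
      -- although it is 1.
      normalized z z∈ z₀≈1 eq = 1≉0 (trans (sym z₀≈1) (y-ind z (λ i → fixed∈ (z∈ i) (τz≈z i)) eq zero))
        where
        τz-z : Vector Carrier (suc d)
        τz-z i = τ (z i) - z i
        comb-τz≈0 : comb (τ ∘ z) y ≈ 0#
        -- Applying f twists the coefficients by τ and multiplies every term by the same μ, which
        -- can then be cancelled.
        comb-τz≈0 = cancel-nonzero μ≉0 (begin
          μ · comb (τ ∘ z) y            ≈⟨ comb-scaled μ (τ ∘ z) y ⟨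
          comb (τ ∘ z) (λ i → μ · y i)  ≈⟨ comb-congʳ (τ ∘ z) fy≈μy ⟨
          comb (τ ∘ z) (f ∘ y)          ≈⟨ semilinear-comb f-cong f-+ f-* {b = y} z∈ ⟨
          f (comb z y)                  ≈⟨ f-cong eq ⟩
          f 0#                          ≈⟨ additive-0 f-cong f-+ ⟩
          0#                            ∎)
        τz₀≈z₀ : τ (z zero) ≈ z zero
        τz₀≈z₀ = trans (τ-cong z₀≈1) (trans τ-1 (sym z₀≈1))
        difference : comb τz-z y ≈ 0#
        difference = begin
          comb τz-z y                               ≈⟨ comb-+ (τ ∘ z) (λ i → - z i) y ⟩
          comb (τ ∘ z) y + comb (λ i → - z i) y     ≈⟨ +-cong comb-τz≈0 (comb-neg z y) ⟩
          0# - comb z y                             ≈⟨ +-identityˡ _ ⟩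
          - comb z y                                ≈⟨ -‿cong eq ⟩
          - 0#                                      ≈⟨ ε⁻¹≈ε ⟩
          0#                                        ∎
        τz≈z : ∀ i → τ (z i) ≈ z i
        τz≈z zero    = τz₀≈z₀
        τz≈z (suc i) = x∙y⁻¹≈ε⇒x≈y _ _
          (tail-ind (τz-z ∘ suc) (λ i → +-closed (τ∈ (z∈ (suc i))) (neg-closed (z∈ (suc i))))
            (tail≈0 τz-z (x≈y⇒x∙y⁻¹≈ε τz₀≈z₀) difference) i)
      vanish : ∀ i → x i ≈ 0#
      vanish i with x zero ≟ 0#
      vanish zero    | yes x₀≈0 = x₀≈0
      vanish (suc i) | yes x₀≈0 = tail-ind (x ∘ suc) (x∈ ∘ suc) (tail≈0 x x₀≈0 eq) i
      vanish i       | no  x₀≉0 with r , x₀r≈1 ← inverse (x zero) x₀≉0 = contradiction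
        (trans (comb-* r x y) (trans (*-congˡ eq) (zeroʳ r)))
        (normalized (λ i → r · x i) (λ i → *-closed (inv-closed (x∈ zero) x₀r≈1) (x∈ i)) (trans (*-comm _ _) x₀r≈1))

-- Weights are found by a basis search in the plane, which needs an enumeration of its vectors.
plane-order : ∀ {c ℓ} (K : Field c ℓ) {N} → HasOrder (Field.setoid K) N →
              HasOrder (Module.≈ᴹ-setoid (plane K)) (N * N)
plane-order K {N} order = record
  { to        = λ (x , y) → combine (to x) (to y)
  ; from      = decode
  ; to-cong   = λ (x≈ , y≈) → ≡.cong₂ combine (to-cong x≈) (to-cong y≈)
  ; from-cong = λ { ≡.refl → refl , refl }
  ; inverse   =
    (λ {i} (x≈ , y≈) → ≡.trans
      (≡.cong₂ combine (≡.trans (to-cong x≈) (to-from order _)) (≡.trans (to-cong y≈) (to-from order _)))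
      (Fin.combine-remQuot {N} N i)) ,
    (λ { {x , y} ≡.refl →
      trans (from-cong (≡.cong proj₁ (Fin.remQuot-combine (to x) (to y)))) (from-to order x) ,
      trans (from-cong (≡.cong proj₂ (Fin.remQuot-combine (to x) (to y)))) (from-to order y) })
  }
  where
  open Field K using (Carrier; refl; trans)
  open Inverse order
  decode : Fin (N * N) → Carrier × Carrier
  decode i = from (proj₁ (remQuot {N} N i)) , from (proj₂ (remQuot {N} N i))

-- The maps `G`, `σ` and `F`

module LinearSets {c ℓ p₁ p₂ : Level} (q n t s : ℕ)
    .{{_ : NonZero n}} .{{_ : NonZero t}}
    (q-prime-power : IsPrimePower q) (s⊥n : gcd s n ≡ 1)
    (K : Field c ℓ) (order : HasOrder (Field.setoid K) (q ^ (n * t)))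
    (𝔽q : Subfield K p₁) (order-q : HasOrder (Subfield.subsetoid 𝔽q) q)
    (𝔽qⁿ : Subfield K p₂) (order-qⁿ : HasOrder (Subfield.subsetoid 𝔽qⁿ) (q ^ n))
    (a : Vector (Field.Carrier K) t) where
  open Field K hiding (zero) renaming (_*_ to _·_; _^_ to _↑_)
  open FieldProperties K
  open import Algebra.Properties.CommutativeSemiring.Exp commutativeSemiring
    using (^-congˡ; ^-congʳ; ^-assocʳ; ^-distrib-*)
  open import Algebra.Properties.Semiring.Sum semiring
    using (sum; sum-cong-≋; ∑-distrib-+; *-distribˡ-sum)
  open import Algebra.Properties.CommutativeSemigroup *-commutativeSemigroup using (x∙yz≈y∙xz)
  open import Relation.Binary.Reasoning.Setoid setoid

  G σ F : Carrier → Carrier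
  G = linearized K q n a
  σ = frobenius K q s
  F = G ∘ σ

  module 𝔽q = Subfield 𝔽q
  module 𝔽qⁿ = Subfield 𝔽qⁿ
  module Lineq = Line K 𝔽q
  module Lineqⁿ = Line K 𝔽qⁿ
  module Plane = VectorSpace K 𝔽q (plane K)
  module PlaneModule = Module (plane K)

  _≟_ : Decidable _≈_
  _≟_ = finite⇒≟ order

  1<q : 1 < q
  1<q = SubfieldProperties.1<order 𝔽q order-q

  instance
    q≢0 : NonZero q
    q≢0 = ℕ.>-nonZero (ℕ.<-trans (s≤s z≤n) 1<q)

  ↑q^-+ : ∀ j → AdditivePower (q ^ j)
  ↑q^-+ = frobenius-additive {M = n * t} q-prime-power order

  𝔽q-fixed : ∀ {α} → α ∈ 𝔽q.Mem → ∀ j → α ↑ (q ^ j) ≈ α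
  𝔽q-fixed {α} α∈ j = trans (^-congʳ α (≡.cong (q ^_) (≡.sym (ℕ.*-identityʳ j))))
    (fixed-iterate q 1 (trans (^-congʳ α (ℕ.^-identityʳ q)) (∈⇒^order≈id _≟_ 𝔽q order-q α∈)) j)

  𝔽qⁿ-fixed : ∀ {α} → α ∈ 𝔽qⁿ.Mem → α ↑ (q ^ n) ≈ α
  𝔽qⁿ-fixed = ∈⇒^order≈id _≟_ 𝔽qⁿ order-qⁿ

  -- Here the coprimality of s and n enters: the q^s-th and the q^n-th power both fix α, hence so
  -- does the q-th.
  σ-fixed⇒∈𝔽q : ∀ {α} → α ∈ 𝔽qⁿ.Mem → σ α ≈ α → α ∈ 𝔽q.Mem
  σ-fixed⇒∈𝔽q α∈ σα≈α = ^order≈id⇒∈ _≟_ 𝔽q order-q (fixed-coprime q s n s⊥n σα≈α (𝔽qⁿ-fixed α∈))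

  σ-cong : ∀ {x y} → x ≈ y → σ x ≈ σ y
  σ-cong = ^-congˡ (q ^ s)

  σ∈𝔽qⁿ : ∀ {α} → α ∈ 𝔽qⁿ.Mem → σ α ∈ 𝔽qⁿ.Mem
  σ∈𝔽qⁿ = ^-closed 𝔽qⁿ (q ^ s)

  σ-injective : ∀ {x y} → σ x ≈ σ y → x ≈ y
  σ-injective = power-injective ⦃ ℕ.m^n≢0 q s ⦄ _≟_ (↑q^-+ s)

  summand : Carrier → Vector Carrier t
  summand x i = a i · x ↑ (q ^ (n * toℕ i))

  G-cong : ∀ {x y} → x ≈ y → G x ≈ G y
  G-cong {x} {y} x≈y = sum-cong-≋ {t} {summand x} {summand y} λ i →
    *-congˡ (^-congˡ (q ^ (n * toℕ i)) x≈y)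

  G-+ : ∀ x y → G (x + y) ≈ G x + G y
  G-+ x y = trans
    (sum-cong-≋ {t} {summand (x + y)} {λ i → summand x i + summand y i} λ i →
      trans (*-congˡ (↑q^-+ (n * toℕ i) x y)) (distribˡ (a i) _ _))
    (∑-distrib-+ (summand x) (summand y))

  -- All exponents in `G` are powers of q^n, so the scalar comes out of each term unchanged.
  -- Assuming an equation on α instead of membership makes this apply to both subfields.
  G-* : ∀ {α} → α ↑ (q ^ n) ≈ α → ∀ x → G (α · x) ≈ α · G x
  G-* {α} fixed x = trans
    (sum-cong-≋ {t} {summand (α · x)} {λ i → α · summand x i} summand-*)
    (sym (*-distribˡ-sum α (summand x)))
    where
    summand-* : ∀ i → summand (α · x) i ≈ α · summand x i
    summand-* i = begin
      a i · (α · x) ↑ e            ≈⟨ *-congˡ (^-distrib-* α x e) ⟩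
      a i · (α ↑ e · x ↑ e)        ≈⟨ *-congˡ (*-congʳ αᵉ≈α) ⟩
      a i · (α · x ↑ e)            ≈⟨ x∙yz≈y∙xz (a i) α _ ⟩
      α · (a i · x ↑ e)            ∎
      where
      e : ℕ
      e = q ^ (n * toℕ i)
      αᵉ≈α : α ↑ e ≈ α
      αᵉ≈α = trans (^-congʳ α (≡.cong (q ^_) (ℕ.*-comm n (toℕ i)))) (fixed-iterate q n fixed (toℕ i))

  F-cong : ∀ {x y} → x ≈ y → F x ≈ F y
  F-cong = G-cong ∘ σ-cong

  F-+ : ∀ x y → F (x + y) ≈ F x + F y
  F-+ x y = trans (G-cong (↑q^-+ s x y)) (G-+ (σ x) (σ y))

  F-semilinear : ∀ {α} → α ∈ 𝔽qⁿ.Mem → ∀ x → F (α · x) ≈ σ α · F x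
  F-semilinear {α} α∈ x =
    trans (G-cong (^-distrib-* α x (q ^ s))) (G-* (𝔽qⁿ-fixed (σ∈𝔽qⁿ α∈)) (σ x))

  F-linear : ∀ {α} → α ∈ 𝔽q.Mem → ∀ x → F (α · x) ≈ α · F x
  F-linear {α} α∈ x = trans (G-cong (trans (^-distrib-* α x (q ^ s)) (*-congʳ (𝔽q-fixed α∈ s))))
                            (G-* (𝔽q-fixed α∈ n) (σ x))

  -- The kernel of `G` over both subfields

  ker-subspaceqⁿ : Lineqⁿ.IsSubspace (ker K G)
  ker-subspaceqⁿ = Lineqⁿ.linear⇒ker-subspace G-cong G-+ (λ α∈ → G-* (𝔽qⁿ-fixed α∈))

  ker-subspaceq : Lineq.IsSubspace (ker K G)
  ker-subspaceq = Lineq.linear⇒ker-subspace G-cong G-+ (λ α∈ → G-* (𝔽q-fixed α∈ n))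

  ker-dimqⁿ : ∃[ k ] HasDim K 𝔽qⁿ (line K) (ker K G) k
  ker-dimqⁿ = Lineqⁿ.Finite.basis order-qⁿ _≟_ order ker-subspaceqⁿ (λ x → G x ≟ 0#)

  ker-dimq : ∃[ d ] HasDim K 𝔽q (line K) (ker K G) d
  ker-dimq = Lineq.Finite.basis order-q _≟_ order ker-subspaceq (λ x → G x ≟ 0#)

  -- The same set counted twice: q^d = (q^n)^k. Each inequality uses the identity map.
  ker-dims : ∀ {d k} → HasDim K 𝔽q (line K) (ker K G) d → HasDim K 𝔽qⁿ (line K) (ker K G) k → d ≡ n * k
  ker-dims {d} {k} dimq dimqⁿ = ℕ.≤-antisym
    (^-cancelʳ-≤ 1<q (≡.subst (q ^ d ≤_) (ℕ.^-*-assoc q n k)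
      (dimension-≤ K 𝔽q order-q 𝔽qⁿ order-qⁿ (line K) (line K) (ker K G) (ker K G)
        dimq dimqⁿ (λ x → x) (λ x∈ → x∈) (λ _ _ eq → eq))))
    (^-cancelʳ-≤ 1<q (≡.subst (_≤ q ^ d) (ℕ.^-*-assoc q n k)
      (dimension-≤ K 𝔽qⁿ order-qⁿ 𝔽q order-q (line K) (line K) (ker K G) (ker K G)
        dimqⁿ dimq (λ x → x) (λ x∈ → x∈) (λ _ _ eq → eq))))

  -- Weights of points

  graph⇒F : ∀ {v} → v ∈ graph K F → F (proj₁ v) ≈ proj₂ v
  graph⇒F (x , v₁≈x , v₂≈Fx) = trans (F-cong v₁≈x) (sym v₂≈Fx)

  F⇒graph : ∀ {v} → F (proj₁ v) ≈ proj₂ v → v ∈ graph K F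
  F⇒graph {v} eq = proj₁ v , refl , sym eq

  module _ (P : Point K) where
    open Point P

    graph∩point-subspace : Plane.IsSubspace (graph K F ∩ subspace)
    graph∩point-subspace = record
      { resp = λ (u₁≈v₁ , u₂≈v₂) (u∈ , r , u₁≈ , u₂≈) →
          F⇒graph (trans (F-cong (sym u₁≈v₁)) (trans (graph⇒F u∈) u₂≈v₂)) ,
          r , trans (sym u₁≈v₁) u₁≈ , trans (sym u₂≈v₂) u₂≈
      ; 0∈ = F⇒graph (Lineq.additive-0 F-cong F-+) , 0# , sym (zeroˡ _) , sym (zeroˡ _)
      ; +∈ = λ (u∈ , r , u₁≈ , u₂≈) (v∈ , r′ , v₁≈ , v₂≈) →
          F⇒graph (trans (F-+ _ _) (+-cong (graph⇒F u∈) (graph⇒F v∈))) ,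
          r + r′ , trans (+-cong u₁≈ v₁≈) (sym (distribʳ _ r r′)) ,
                   trans (+-cong u₂≈ v₂≈) (sym (distribʳ _ r r′))
      ; *∈ = λ {α} α∈ (v∈ , r , v₁≈ , v₂≈) →
          F⇒graph (trans (F-linear α∈ _) (*-congˡ (graph⇒F v∈))) ,
          α · r , trans (*-congˡ v₁≈) (sym (*-assoc α r _)) ,
                  trans (*-congˡ v₂≈) (sym (*-assoc α r _))
      }

    graph∩point? : Unary.Decidable (graph K F ∩ subspace)
    graph∩point? v@(v₁ , v₂) = map′ F⇒graph graph⇒F (F v₁ ≟ v₂) ×-dec
      finite⇒∃? order
        (λ r≈r′ (v₁≈ , v₂≈) → trans v₁≈ (*-congʳ r≈r′) , trans v₂≈ (*-congʳ r≈r′))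
        (λ r → (v₁ ≟ (r · proj₁ coords)) ×-dec (v₂ ≟ (r · proj₂ coords)))

    weight : ∃[ w ] HasWeight K 𝔽q F P w
    weight = Plane.Finite.basis order-q _≟_ (plane-order K order) graph∩point-subspace graph∩point?

    -- The nonzero vector (x, F x) lies in the intersection, while an empty basis spans only 0.
    weight-positive : P ∈ LinearSet K F → ∀ {w} → HasWeight K 𝔽q F P w → 1 ≤ w
    weight-positive _ {suc w} _ = s≤s z≤n
    weight-positive (x , x≉0 , _ , ⟨x,Fx⟩⊆P) {zero} (_ , (W⊆Span , _) , _)
      with _ , _ , x≈0 , _ ← W⊆Span {x , F x}
             (F⇒graph refl , ⟨x,Fx⟩⊆P (1# , sym (*-identityˡ x) , sym (*-identityˡ (F x))))
      = contradiction x≈0 x≉0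

    weight-bounded : P ∈ LinearSet K F → ¬ (_≈ₚ_ K P (point-1-0 K)) →
                     ∀ {k w} → HasDim K 𝔽qⁿ (line K) (ker K G) k → HasWeight K 𝔽q F P w → w ≤ t ∸ k
    weight-bounded (x , x≉0 , P⊆⟨x,Fx⟩ , ⟨x,Fx⟩⊆P) P≉⟨1,0⟩ {k} {w}
                   (c , (_ , Span⊆ker) , c-ind) (b , (_ , Span⊆W) , b-ind) =
      -- The sum `k + w ≤ t` is what gets proved; it also shows that `t ∸ k` is a true difference.
      ℕ.m+n≤o⇒m≤o∸n w (≡.subst (_≤ t) (ℕ.+-comm k w) k+w≤t)
      where
      x′ : Carrier
      x′ = proj₁ (inverse x x≉0)
      xx′≈1 : x · x′ ≈ 1#
      xx′≈1 = proj₂ (inverse x x≉0)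
      x′x-cancel : ∀ z → z · x′ · x ≈ z
      x′x-cancel z = trans (*-assoc z x′ x) (trans (*-congˡ (trans (*-comm x′ x) xx′≈1)) (*-identityʳ z))
      Fx≉0 : ¬ (F x ≈ 0#)
      -- If F x = 0, then P is ⟨(x, 0)⟩ = ⟨(1, 0)⟩; the factors x and x′ convert between the two
      -- coordinate vectors.
      Fx≉0 Fx≈0 = P≉⟨1,0⟩
        ( (λ v∈P → let (r , v₁≈ , v₂≈) = P⊆⟨x,Fx⟩ v∈P in
            r · x , trans v₁≈ (sym (*-identityʳ _)) ,
            trans v₂≈ (trans (*-congˡ Fx≈0) (trans (zeroʳ r) (sym (zeroʳ _)))))
        , (λ (r , v₁≈ , v₂≈) → ⟨x,Fx⟩⊆P
            (r · x′ , trans v₁≈ (trans (*-identityʳ r) (sym (x′x-cancel r))) ,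
             trans v₂≈ (trans (zeroʳ r) (sym (trans (*-congˡ Fx≈0) (zeroʳ _)))))))
      μ : Carrier
      -- The slope of P: its vectors are those whose second coordinate is μ times the first.
      μ = F x · x′
      μx≈Fx : μ · x ≈ F x
      μx≈Fx = x′x-cancel (F x)
      μ≉0 : ¬ (μ ≈ 0#)
      μ≉0 μ≈0 = Fx≉0 (trans (sym μx≈Fx) (trans (*-congʳ μ≈0) (zeroˡ x)))
      y z : Vector Carrier w
      y = proj₁ ∘ b
      z = σ ∘ y
      b∈ : ∀ i → b i ∈ graph K F ∩ subspace
      b∈ i = Span⊆W (Plane.∈Span b i)
      b₂≈μy : ∀ i → proj₂ (b i) ≈ μ · y i
      b₂≈μy i with r , b₁≈ , b₂≈ ← P⊆⟨x,Fx⟩ (proj₂ (b∈ i)) = begin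
        proj₂ (b i)       ≈⟨ b₂≈ ⟩
        r · F x           ≈⟨ *-congˡ μx≈Fx ⟨
        r · (μ · x)       ≈⟨ x∙yz≈y∙xz r μ x ⟩
        μ · (r · x)       ≈⟨ *-congˡ b₁≈ ⟨
        μ · y i           ∎
      Fy≈μy : ∀ i → F (y i) ≈ μ · y i
      Fy≈μy i = trans (graph⇒F (proj₁ (b∈ i))) (b₂≈μy i)
      y-indq : Independent K 𝔽q (line K) y
      -- Second coordinates are μ times first ones, so a relation among the `y i` is a relation
      -- among the basis vectors `b i` in the plane.
      y-indq α α∈ eq = b-ind α α∈ (PlaneModule.≈ᴹ-trans (Lineq.comb-zipped α b)
        (eq , (begin
          Lineq.comb α (proj₂ ∘ b)        ≈⟨ Lineq.comb-congʳ α b₂≈μy ⟩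
          Lineq.comb α (λ i → μ · y i)    ≈⟨ Lineq.comb-scaled μ α y ⟩
          μ · Lineq.comb α y              ≈⟨ *-congˡ eq ⟩
          μ · 0#                          ≈⟨ zeroʳ μ ⟩
          0#                              ∎)))
      y-indqⁿ : Independent K 𝔽qⁿ (line K) y
      y-indqⁿ = Lineqⁿ.eigenvectors-independent _≟_ 𝔽q σ-cong (1^ (q ^ s)) σ∈𝔽qⁿ σ-fixed⇒∈𝔽q
        F-cong F-+ F-semilinear μ≉0 Fy≈μy y-indq
      c++z-ind : Independent K 𝔽qⁿ (line K) (c ++ z)
      c++z-ind = Lineqⁿ.independent-++ μ≉0 G-cong G-+ (λ α∈ → G-* (𝔽qⁿ-fixed α∈))
        c-ind (λ {α} α∈ → Span⊆ker (α , α∈ , refl)) y-indqⁿ Fy≈μy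
      k+w≤t : k ℕ.+ w ≤ t
      -- The k + w independent elements have (q^n)^(k + w) combinations inside `K`, which has only
      -- q^(nt) elements.
      k+w≤t = ℕ.*-cancelˡ-≤ n (^-cancelʳ-≤ 1<q (≡.subst (_≤ q ^ (n * t)) (ℕ.^-*-assoc q n (k ℕ.+ w))
        (Lineqⁿ.Finite.independent⇒m^d≤ order-qⁿ c++z-ind
          (λ α _ → Inverse.to order (Lineqⁿ.comb α (c ++ z))) (to-injective order))))

  -- The intersection consists of the (x, 0) with G(σ x) = 0, and `σ` matches these x with ker G.
  -- The two inequalities count along `σ` and along its inverse.
  weight-⟨1,0⟩ : ∀ {w d} → HasWeight K 𝔽q F (point-1-0 K) w → HasDim K 𝔽q (line K) (ker K G) d → w ≡ d
  weight-⟨1,0⟩ has-weight has-dim = ℕ.≤-antisym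
    (^-cancelʳ-≤ 1<q (dimension-≤ K 𝔽q order-q 𝔽q order-q (plane K) (line K) U∩⟨1,0⟩ (ker K G)
      has-weight has-dim
      (σ ∘ proj₁) (λ {v} (v∈ , _ , _ , v₂≈) → trans (graph⇒F {v} v∈) (v₂≈0 v₂≈))
      (λ (_ , _ , _ , u₂≈) (_ , _ , _ , v₂≈) σu₁≈σv₁ →
        σ-injective σu₁≈σv₁ , trans (v₂≈0 u₂≈) (sym (v₂≈0 v₂≈)))))
    (^-cancelʳ-≤ 1<q (dimension-≤ K 𝔽q order-q 𝔽q order-q (line K) (plane K) (ker K G) U∩⟨1,0⟩
      has-dim has-weight
      (λ y → σ⁻¹ y , 0#)
      (λ {y} Gy≈0 → F⇒graph (trans (G-cong (σσ⁻¹ y)) Gy≈0) ,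
        σ⁻¹ y , sym (*-identityʳ _) , sym (zeroʳ _))
      (λ {u} {v} _ _ (eq , _) → trans (sym (σσ⁻¹ u)) (trans (σ-cong eq) (σσ⁻¹ v)))))
    where
    U∩⟨1,0⟩ : Pred (Carrier × Carrier) (c ⊔ ℓ)
    U∩⟨1,0⟩ = graph K F ∩ Point.subspace (point-1-0 K)
    v₂≈0 : ∀ {r v₂} → v₂ ≈ r · 0# → v₂ ≈ 0#
    v₂≈0 v₂≈ = trans v₂≈ (zeroʳ _)
    e : ℕ
    e = s * (n * t) ∸ s
    -- σ has finite order dividing nt, so its inverse is σⁿᵗ⁻¹.
    σ⁻¹ : Carrier → Carrier
    σ⁻¹ y = y ↑ (q ^ e)
    σσ⁻¹ : ∀ y → σ (σ⁻¹ y) ≈ y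
    σσ⁻¹ y = begin
      (y ↑ (q ^ e)) ↑ (q ^ s)       ≈⟨ ^-assocʳ y (q ^ e) (q ^ s) ⟩
      y ↑ (q ^ e * q ^ s)           ≈⟨ ^-congʳ y (ℕ.^-distribˡ-+-* q e s) ⟨
      y ↑ (q ^ (e ℕ.+ s))           ≈⟨ ^-congʳ y (≡.cong (q ^_) (ℕ.m∸n+n≡m (ℕ.m≤m*n s (n * t) ⦃ ℕ.m*n≢0 n t ⦄))) ⟩
      y ↑ (q ^ (s * (n * t)))       ≈⟨ fixed-iterate q (n * t) (^order≈id order y) s ⟩
      y                             ∎

theorem7p1 :
    ∀ {c ℓ p₁ p₂} (q n t s : ℕ) .{{_ : NonZero n}} .{{_ : NonZero t}} .{{_ : NonZero s}} →
    IsPrimePower q →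
    gcd s n ≡ 1 →
    (K : Field c ℓ) → HasOrder (Field.setoid K) (q ^ (n * t)) →
    (𝔽q : Subfield K p₁) → HasOrder (Subfield.subsetoid 𝔽q) q →
    (𝔽qⁿ : Subfield K p₂) → HasOrder (Subfield.subsetoid 𝔽qⁿ) (q ^ n) →
    (a : Vector (Field.Carrier K) t) →
    let G = linearized K q n a
        F = G ∘ frobenius K q s
    in
    ∃[ k ] HasDim K 𝔽qⁿ (line K) (ker K G) k
      × (∀ P → P ∈ LinearSet K F → ¬ (_≈ₚ_ K P (point-1-0 K)) →
           ∃[ w ] HasWeight K 𝔽q F P w × 1 ≤ w × w ≤ t ∸ k)
      × (∃[ w ] HasWeight K 𝔽q F (point-1-0 K) w
           × HasDim K 𝔽q (line K) (ker K G) w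
           × w ≡ n * k)
theorem7p1 q n t s q-prime-power s⊥n K order 𝔽q order-q 𝔽qⁿ order-qⁿ a =
  proj₁ ker-dimqⁿ , proj₂ ker-dimqⁿ ,
  (λ P P∈ P≉ → let (w , has-weight) = weight P in
    w , has-weight , weight-positive P P∈ has-weight ,
    weight-bounded P P∈ P≉ (proj₂ ker-dimqⁿ) has-weight) ,
  proj₁ ker-dimq ,
  -- The witness is the dimension of ker G over `𝔽q`; the weight found by search is carried over to
  -- it along their equality.
  ≡.subst (HasWeight K 𝔽q F (point-1-0 K)) (weight-⟨1,0⟩ (proj₂ (weight (point-1-0 K))) (proj₂ ker-dimq))
    (proj₂ (weight (point-1-0 K))) ,
  proj₂ ker-dimq ,
  ker-dims (proj₂ ker-dimq) (proj₂ ker-dimqⁿ)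
  where
  open LinearSets q n t s q-prime-power s⊥n K order 𝔽q order-q 𝔽qⁿ order-qⁿ a
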